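{- Let $X,H,M\ge1$ with $X^{1/3}\le H\le X$ and $M\le C_0X^{1/2}$ for a fixed constant $C_0$, and let $J$ be a subinterval of $(M,2M]$. Then there are constants $0<c_1<c_2$ and $C>0$ depending only on $C_0$ such that for any integer $Q$ with $\frac MH\le Q\le\frac M{(HX)^{1/4}}$, the set $\{(m,n)\in\mathbb Z^2:m\in J,\ X<nm\le X+H\}$ can be partitioned as $$\bigcup_{q=1}^Q\ \bigcup_{\substack{c_1\frac X{M^2}q\le a\le c_2\frac X{M^2}q\\ \gcd(a,q)=1}}\ \bigcup_{P\in\mathcal P_{a,q}}P,$$ where for each such coprime pair $(a,q)$, $\mathcal P_{a,q}$ is a family of at most $C\frac{M^3}{XQ^2q}$ arithmetic progressions $P$ contained in the set, each of spacing $(q,-a)$ and length at most $\frac{HQ}M$.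
   Context: An arithmetic progression in $\mathbb Z^2$ of spacing $v$ is a set $\{x_0+jv:0\le j<\ell\}$, with $\ell$ its length. -}

module Defs where

open import Algebra.Bundles using (CommutativeRing)
open import Data.Bool.Base using (Bool; true; false)
open import Data.Integer.Base as ℤ using (ℤ; +_; -[1+_])
open import Data.Integer.GCD using (gcd)
open import Data.List.Base using (List; length)
open import Data.List.Membership.Propositional using () renaming (_∈_ to _∈ₗ_)
open import Data.Nat.Base as ℕ using (ℕ; suc)
open import Data.Product.Base using (_×_; _,_; ∃)
open import Level using (Level; _⊔_) renaming (suc to lsuc)
open import Relation.Binary.Core using (Rel)
open import Relation.Binary.PropositionalEquality.Core using (_≡_)
open import Relation.Binary.Structures using (IsStrictTotalOrder)
open import Relation.Nullary.Negation.Core using (¬_)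
open import Relation.Unary using (Pred; _∈_; _⊆_; Satisfiable)
import Algebra.Properties.Monoid.Mult as Mult
import Algebra.Properties.Semiring.Exp as Exp
import Relation.Binary.Construct.StrictToNonStrict as NonStrict

-- The library has no real numbers. This is the part of the structure of ℝ
-- used to state real inequalities: a totally ordered Archimedean field with
-- k-th roots of non-negative elements. ℝ is (classically) a model, and every
-- model embeds in ℝ, so no ordered field larger than ℝ is admitted.
-- Trichotomy, part of IsStrictTotalOrder, makes the order decidable.
record RealField (c ℓ₁ ℓ₂ : Level) : Set (lsuc (c ⊔ ℓ₁ ⊔ ℓ₂)) where
  infix  4 _<_
  infixl 7 _/_
  infixl 8 _^1/_
  field
    commutativeRing : CommutativeRing c ℓ₁

  open CommutativeRing commutativeRing public

  field
    _<_                : Rel Carrier ℓ₂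
    isStrictTotalOrder : IsStrictTotalOrder _≈_ _<_

  open NonStrict _≈_ _<_ public using (_≤_)
  open Exp semiring public using (_^_)

  -- n ×ℕ x is the n-fold sum of x.
  open Mult +-monoid public using () renaming (_×_ to _×ℕ_)

  field
    0<1         : 0# < 1#
    +-monoˡ-<   : ∀ {x y} z → x < y → x + z < y + z
    *-pos       : ∀ {x y} → 0# < x → 0# < y → 0# < x * y
    -- The values 0# ⁻¹ and x ^1/ k for x < 0# are unconstrained.
    _⁻¹         : Carrier → Carrier
    ⁻¹-inverseʳ : ∀ {x} → ¬ (x ≈ 0#) → x * x ⁻¹ ≈ 1#
    archimedean : ∀ x → ∃ λ n → x < n ×ℕ 1#
    _^1/_       : Carrier → (k : ℕ) → .{{ℕ.NonZero k}} → Carrier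
    ^1/-nonNeg  : ∀ k .{{_ : ℕ.NonZero k}} {x} → 0# ≤ x → 0# ≤ x ^1/ k
    ^1/-root    : ∀ k .{{_ : ℕ.NonZero k}} {x} → 0# ≤ x → (x ^1/ k) ^ k ≈ x

  _/_ : Carrier → Carrier → Carrier
  x / y = x * y ⁻¹

  2# : Carrier
  2# = 1# + 1#

  fromℕ : ℕ → Carrier
  fromℕ n = n ×ℕ 1#

  fromℤ : ℤ → Carrier
  fromℤ (+ n)    = fromℕ n
  fromℤ -[1+ n ] = - fromℕ (suc n)

ℤ² : Set
ℤ² = ℤ × ℤ

-- The spacing is kept as data, since the set of points does not determine it
-- when there is at most one point.
record Progression : Set where
  constructor progression
  field
    start   : ℤ²
    spacing : ℤ²
    len     : ℕ

_+[_]_ : ℤ² → ℕ → ℤ² → ℤ²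
(x , y) +[ j ] (u , v) = x ℤ.+ + j ℤ.* u , y ℤ.+ + j ℤ.* v

points : Progression → Pred ℤ² _
points P x = ∃ λ j → j ℕ.< len × x ≡ start +[ j ] spacing
  where open Progression P

-- The blocks are those with index in K. Distinct indices are required to give
-- disjoint blocks.
record IsPartition {a i s k b} {A : Set a} {I : Set i}
                   (S : Pred A s) (K : Pred I k) (block : I → Pred A b)
                   : Set (a ⊔ i ⊔ s ⊔ k ⊔ b) where
  field
    nonempty  : ∀ {i} → i ∈ K → Satisfiable (block i)
    contained : ∀ {i} → i ∈ K → block i ⊆ S
    covers    : ∀ {x} → x ∈ S → ∃ λ i → i ∈ K × x ∈ block i
    disjoint  : ∀ {i j x} → i ∈ K → j ∈ K → x ∈ block i → x ∈ block j → i ≡ j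

module Hyperbola {c ℓ₁ ℓ₂} (𝔽 : RealField c ℓ₁ ℓ₂) where
  open RealField 𝔽

  record Interval : Set c where
    field
      lower upper             : Carrier
      lowerClosed upperClosed : Bool

  before : Bool → Carrier → Carrier → Set (ℓ₁ ⊔ ℓ₂)
  before true  x y = x ≤ y
  before false x y = Level.Lift ℓ₁ (x < y)

  within : Interval → Pred Carrier (ℓ₁ ⊔ ℓ₂)
  within J x = before lowerClosed lower x × before upperClosed x upper
    where open Interval J

  ⦅_,_⦆ˡ : Carrier → Carrier → Interval
  ⦅ x , y ⦆ˡ = record
    { lower = x ; upper = y ; lowerClosed = false ; upperClosed = true }

  region : Carrier → Carrier → Interval → Pred ℤ² (ℓ₁ ⊔ ℓ₂)
  region X H J (m , n) =
    fromℤ m ∈ within J × X < fromℤ (n ℤ.* m) × fromℤ (n ℤ.* m) ≤ X + H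

  Admissible : (c₁ c₂ X M : Carrier) (Q : ℤ) → Pred (ℤ × ℤ) (ℓ₁ ⊔ ℓ₂)
  Admissible c₁ c₂ X M Q (a , q) =
    (ℤ.1ℤ ℤ.≤ q × q ℤ.≤ Q) ×
    (c₁ * (X / M ^ 2) * fromℤ q ≤ fromℤ a ×
     fromℤ a ≤ c₂ * (X / M ^ 2) * fromℤ q) ×
    gcd a q ≡ ℤ.1ℤ

  record Decomposition (c₁ c₂ C X H M : Carrier) (J : Interval) (Q : ℤ)
                       : Set (c ⊔ ℓ₁ ⊔ ℓ₂) where
    field
      family : ℤ × ℤ → List Progression

    -- Blocks are indexed by (a , q) together with P in the family of (a , q).
    Index : Pred ((ℤ × ℤ) × Progression) (ℓ₁ ⊔ ℓ₂)
    Index (aq , P) = aq ∈ Admissible c₁ c₂ X M Q × P ∈ₗ family aq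

    field
      partition : IsPartition (region X H J) Index (λ (_ , P) → points P)
      count     : ∀ {a q} → (a , q) ∈ Admissible c₁ c₂ X M Q →
                  fromℕ (length (family (a , q)))
                    ≤ C * (M ^ 3 / (X * fromℤ Q ^ 2 * fromℤ q))
      spacing   : ∀ {a q P} → ((a , q) , P) ∈ Index →
                  Progression.spacing P ≡ (q , ℤ.- a)
      len       : ∀ {a q P} → ((a , q) , P) ∈ Index →
                  fromℕ (Progression.len P) ≤ H * fromℤ Q / M

{-# OPTIONS --safe #-}
module Submission where

-- File each point (m , n) of the region under a fraction a/q with
-- |n/m - a/q| < 1/(q Q) and q ≤ Q, taking q and then a minimal. On a line
-- a m + q n = t, put d = a m - q n; then t² - d² = 4 a q n m, so the points of
-- the line in the region and filed under a/q form one run with d ≥ 0 and one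
-- with d < 0. Cut every run into blocks of length at most H Q / M.
--
-- With σ² = 4 a q X, the condition on n m reads σ² < t² - d² ≤ σ² + 4 a q H.
-- Hence the k-th line has t ≥ σ + k, where k is at most a multiple of
-- U = M³ / (X Q² q), and its runs are cut into 1 + e blocks with e² k at most a
-- multiple of U (and e at most a multiple of U when k = 0). Summing over k,
-- since ∑ 1/√k ≤ 2 √U over k ≤ U, there are O(U) blocks.

open import Defs
open import Algebra.Bundles using (AbelianGroup)
import Algebra.Properties.AbelianGroup
import Algebra.Properties.Group
import Algebra.Properties.Ring
import Algebra.Properties.Semiring.Mult
import Algebra.Solver.Ring
open import Algebra.Solver.Ring.AlmostCommutativeRing using (fromCommutativeRing; _-Raw-AlmostCommutative⟶_)
open import Data.Bool.Base using (Bool; true; false)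
open import Data.Empty using (⊥; ⊥-elim)
open import Data.Fin.Base using (toℕ; fromℕ<)
import Data.Fin.Properties as Fin
open import Data.Integer.Base as ℤ using (ℤ; +_; -[1+_]; 1ℤ)
import Data.Integer.GCD as ℤ
import Data.Integer.Properties as ℤ
import Data.Integer.Tactic.RingSolver as ℤSolver
open import Data.List.Base using (List; []; _++_; length; map; upTo)
open import Data.List.Membership.Propositional using () renaming (_∈_ to _∈ₗ_)
open import Data.List.Membership.Propositional.Properties
  using (∈-++⁻; ∈-++⁺ˡ; ∈-++⁺ʳ; ∈-map⁻; ∈-map⁺; ∈-upTo⁺; ∈-upTo⁻)
open import Data.List.Properties using (length-++; length-map; length-upTo)
open import Data.Maybe.Base using (Maybe; just; nothing)
open import Data.Nat.Base as ℕ using (ℕ; zero; suc)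
import Data.Nat.Divisibility as ℕ
import Data.Nat.GCD as ℕ
import Data.Nat.Properties as ℕ
import Data.Nat.Tactic.RingSolver as ℕSolver
open import Data.Product.Base using (_×_; _,_; ∃; ∃₂; Σ-syntax; proj₁; proj₂)
open import Data.Product.Properties using (≡-dec)
open import Data.Sum.Base using (_⊎_; inj₁; inj₂)
open import Level using (Level; Lift; lift; _⊔_)
import Relation.Binary.Construct.StrictToNonStrict
open import Relation.Binary.Definitions using (tri<; tri≈; tri>)
open import Relation.Binary.PropositionalEquality as ≡ using (_≡_)
import Relation.Binary.Reasoning.Setoid
open import Relation.Binary.Structures using (IsStrictTotalOrder)
open import Relation.Nullary using (¬_; Dec; yes; no)
open import Relation.Nullary.Decidable using (_×-dec_; map′)
open import Relation.Unary using (Pred; _∈_; _⊆_; _∪_; Satisfiable)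

-- The line `a m + q n = σ` is the tangent of slope `-a/q` to the hyperbola `n m = X`, and the lines
-- that matter lie just beyond it. A point filed under `a/q` has `|d| Q` at most a multiple of `M`,
-- so it stays near the point of tangency; this bounds `t` and with it the number of lines.
--
-- Filing under an arbitrary Dirichlet fraction could scatter the points of one line over many runs.
-- Minimality of `q` prevents this: a fraction `b/r` of another value with `r ≤ Q` differs from
-- `a/q` by at least `1/(q r) ≥ 1/(q Q)`, so it never lies inside the arc of `a/q`.
--
-- A long run needs `n m` to vary slowly, which happens only near tangency; hence the decay like
-- `1/√k`. The nearest line has no such gain and gets its own bound. `X ≤ H³` and `Q w ≤ M` with
-- `w⁴ = H X` give `U ≥ 1`, which absorbs all rounding, and `M ≤ H Q` makes the block length at
-- least 1.
--
-- When `Q X` is small against `M²`, the fraction 0/1 may come out as the choice although it is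
-- outside the permitted range of `a`; but then `Q` is bounded and 1/1 can take its place.

module Combinatorics where
  open import Data.Nat.Base
  open import Data.Nat.DivMod
  open import Data.Nat.Properties
  open import Data.Nat.Solver using (module +-*-Solver)
  open +-*-Solver using (solve; _:+_; _:*_; _:=_; con)
  open ≡ hiding ([_])

  -- Finite sums, convex sets of naturals, and Dirichlet approximation

  ∑< : ℕ → (ℕ → ℕ) → ℕ
  ∑< zero    f = 0
  ∑< (suc n) f = ∑< n f + f n

  ∑<-mono : ∀ n {f g : ℕ → ℕ} → (∀ {k} → k < n → f k ≤ g k) → ∑< n f ≤ ∑< n g
  ∑<-mono zero    h = z≤n
  ∑<-mono (suc n) h = +-mono-≤ (∑<-mono n (λ k<n → h (m<n⇒m<1+n k<n))) (h ≤-refl)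

  ∑<-suc : ∀ n (f : ℕ → ℕ) → ∑< n (λ k → suc (f k)) ≡ n + ∑< n f
  ∑<-suc zero    f = refl
  ∑<-suc (suc n) f = trans (cong (_+ suc (f n)) (∑<-suc n f))
    (solve 3 (λ n s x → (n :+ s) :+ (con 1 :+ x) := (con 1 :+ n) :+ (s :+ x)) refl n (∑< n f) (f n))

  ∑<-head : ∀ n (f : ℕ → ℕ) → ∑< (suc n) f ≡ f 0 + ∑< n (λ k → f (suc k))
  ∑<-head zero    f = sym (+-identityʳ (f 0))
  ∑<-head (suc n) f = trans (cong (_+ f (suc n)) (∑<-head n f)) (+-assoc (f 0) _ _)

  2xy≤x²+y² : ∀ x y → 2 * (x * y) ≤ x * x + y * y
  2xy≤x²+y² x y with ≤-total x y
  ... | inj₁ x≤y = subst (λ y → 2 * (x * y) ≤ x * x + y * y) (m+[n∸m]≡n x≤y) (lemma x (y ∸ x))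
    where
    lemma : ∀ x d → 2 * (x * (x + d)) ≤ x * x + (x + d) * (x + d)
    lemma x d = m+n≤o⇒m≤o (2 * (x * (x + d))) (≤-reflexive
      (solve 2 (λ x d → con 2 :* (x :* (x :+ d)) :+ d :* d := x :* x :+ (x :+ d) :* (x :+ d)) refl x d))
  ... | inj₂ y≤x = subst (λ x → 2 * (x * y) ≤ x * x + y * y) (m+[n∸m]≡n y≤x) (lemma y (x ∸ y))
    where
    lemma : ∀ y d → 2 * ((y + d) * y) ≤ (y + d) * (y + d) + y * y
    lemma y d = m+n≤o⇒m≤o (2 * ((y + d) * y)) (≤-reflexive
      (solve 2 (λ y d → con 2 :* ((y :+ d) :* y) :+ d :* d := (y :+ d) :* (y :+ d) :+ y :* y) refl y d))

  square-cancel-≤ : ∀ {x y} → x * x ≤ y * y → x ≤ y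
  square-cancel-≤ {x} {y} h with x ≤? y
  ... | yes p = p
  ... | no p  = ⊥-elim (<⇒≱ (*-mono-< (≰⇒> p) (≰⇒> p)) h)

  -- This is ∑ 1/√k ≤ 2√V, scaled by √V; the induction step is AM-GM.
  ∑-inverse-sqrt : ∀ V (e : ℕ → ℕ) → (∀ {k} → k < V → e k * e k * suc k ≤ V) → ∑< V e ≤ 2 * V
  ∑-inverse-sqrt V e h = square-cancel-≤ (≤-trans (squared V ≤-refl)
      (≤-reflexive (solve 1 (λ V → con 4 :* V :* V := con 2 :* V :* (con 2 :* V)) refl V)))
    where
    product-bound : ∀ n s x → s * s ≤ 4 * V * n → s * x ≤ V + n * (x * x)
    product-bound zero s x s²≤ = ≤-trans (≤-reflexive (cong (_* x) s≡0)) z≤n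
      where s≡0 = n≤0⇒n≡0 (square-cancel-≤ {s} {0} (≤-trans s²≤ (≤-reflexive (*-zeroʳ (4 * V)))))
    product-bound n@(suc _) s x s²≤ = *-cancelˡ-≤ (4 * n) (begin
      4 * n * (s * x)                        ≡⟨ solve 3 (λ n s x → con 4 :* n :* (s :* x)
                                                  := con 2 :* (s :* (con 2 :* n :* x))) refl n s x ⟩
      2 * (s * (2 * n * x))                  ≤⟨ 2xy≤x²+y² s (2 * n * x) ⟩
      s * s + 2 * n * x * (2 * n * x)        ≤⟨ +-monoˡ-≤ _ s²≤ ⟩
      4 * V * n + 2 * n * x * (2 * n * x)    ≡⟨ solve 3
          (λ V n x → con 4 :* V :* n :+ con 2 :* n :* x :* (con 2 :* n :* x)
                                                  := con 4 :* n :* (V :+ n :* (x :* x))) refl V n x ⟩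
      4 * n * (V + n * (x * x))              ∎)
      where open ≤-Reasoning

    -- Bounding every partial sum by `2 √(V n)`, squared to avoid roots, is the strengthening that
    -- carries the induction; `n = V` gives the claim.
    squared : ∀ n → n ≤ V → ∑< n e * ∑< n e ≤ 4 * V * n
    squared zero    _   = z≤n
    squared (suc n) n<V = begin
      (s + x) * (s + x)                              ≡⟨ solve 2 (λ s x → (s :+ x) :* (s :+ x)
                                                          := s :* s :+ con 2 :* (s :* x) :+ x :* x) refl
                                                              s x ⟩
      s * s + 2 * (s * x) + x * x                    ≤⟨ +-monoˡ-≤ (x * x)
          (+-mono-≤ s²≤ (*-monoʳ-≤ 2 (product-bound n s x s²≤))) ⟩
      4 * V * n + 2 * (V + n * (x * x)) + x * x      ≤⟨ m≤m+n _ (x * x) ⟩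
      4 * V * n + 2 * (V + n * (x * x)) + x * x + x * x
                                                     ≡⟨ solve 3
                                                         (λ V n x → con 4 :* V :* n :+ con 2 :*
                                                             (V :+ n :* (x :* x)) :+ x :* x :+ x :* x
                                                          := con 4 :* V :* n :+ con 2 :* V :+ con 2 :*
                                                              (x :* x :* (con 1 :+ n))) refl V n x ⟩
      4 * V * n + 2 * V + 2 * (x * x * suc n)        ≤⟨ +-monoʳ-≤ (4 * V * n + 2 * V)
          (*-monoʳ-≤ 2 (h n<V)) ⟩
      4 * V * n + 2 * V + 2 * V                      ≡⟨ solve 2
          (λ V n → con 4 :* V :* n :+ con 2 :* V :+ con 2 :* V
                                                          := con 4 :* V :* (con 1 :+ n)) refl V n ⟩
      4 * V * suc n                                  ∎
      where
      open ≤-Reasoning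
      s = ∑< n e
      x = e n
      s²≤ = squared n (<⇒≤ n<V)

  least : ∀ {p} {P : ℕ → Set p} → (∀ n → Dec (P n)) → ∀ n → P n → ∃ λ m → P m × (∀ k → P k → m ≤ k)
  least P? zero    p = 0 , p , λ _ _ → z≤n
  least P? (suc n) p with P? 0
  ... | yes p₀ = 0 , p₀ , λ _ _ → z≤n
  ... | no ¬p₀ with least (λ k → P? (suc k)) n p
  ...   | m , pm , min = suc m , pm , λ where
          zero    pk → ⊥-elim (¬p₀ pk)
          (suc k) pk → s≤s (min k pk)

  convex-interval : ∀ {p} {P : ℕ → Set p} → (∀ n → Dec (P n)) →
    (∀ {u v w} → u ≤ v → v ≤ w → P u → P w → P v) →
    ∀ B → (∀ {i} → P i → i < B) →
    ∃₂ λ s l → (∀ {i} → P i → s ≤ i × i < s + l) × (∀ {i} → s ≤ i → i < s + l → P i)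
  convex-interval P? convex zero    bound = 0 , 0 , (λ p → z≤n , bound p) , λ _ ()
  convex-interval {P = P} P? convex (suc B) bound
    with convex-interval {P = λ i → P (suc i)} (λ i → P? (suc i))
        (λ u≤v v≤w → convex (s≤s u≤v) (s≤s v≤w)) B (λ p → s≤s⁻¹ (bound p))
  ... | s , l , inside , isP with P? 0
  ...   | no ¬p₀ = suc s , l , inside′ , isP′
    where
    inside′ : ∀ {i} → P i → suc s ≤ i × i < suc s + l
    inside′ {zero}  p = ⊥-elim (¬p₀ p)
    inside′ {suc i} p = s≤s (proj₁ (inside p)) , s≤s (proj₂ (inside p))
    isP′ : ∀ {i} → suc s ≤ i → i < suc s + l → P i
    isP′ (s≤s h) (s≤s k) = isP h k
  convex-interval {P = P} P? convex (suc B) bound | s , zero , inside , isP | yes p₀ = 0 , 1 , inside′ ,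
      isP′
    where
    inside′ : ∀ {i} → P i → 0 ≤ i × i < 1
    inside′ {zero}  p = z≤n , s≤s z≤n
    inside′ {suc i} p = ⊥-elim (<⇒≱ (proj₂ (inside p))
        (≤-trans (≤-reflexive (+-identityʳ s)) (proj₁ (inside p))))
    isP′ : ∀ {i} → 0 ≤ i → i < 1 → P i
    isP′ _ (s≤s z≤n) = p₀
  convex-interval {P = P} P? convex (suc B) bound | s , suc l , inside , isP | yes p₀ = 0 , suc (suc l)
      , inside′ , isP′
    where
    -- The tail is nonempty and contains `suc s`; since 0 also satisfies `P`, convexity puts 1 into
    -- `P`, so the tail has to start at its own index 0.
    s≡0 : s ≡ 0
    s≡0 = n≤0⇒n≡0 (proj₁ (inside (convex z≤n (s≤s z≤n) p₀ (isP ≤-refl (m<m+n s (s≤s z≤n))))))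
    inside′ : ∀ {i} → P i → 0 ≤ i × i < suc (suc l)
    inside′ {zero}  p = z≤n , s≤s z≤n
    inside′ {suc i} p = z≤n , s≤s (subst (λ s → i < s + suc l) s≡0 (proj₂ (inside p)))
    isP′ : ∀ {i} → 0 ≤ i → i < suc (suc l) → P i
    isP′ {zero}  _ _ = p₀
    isP′ {suc i} _ (s≤s h) = isP (subst (_≤ i) (sym s≡0) z≤n) (subst (λ s → i < s + suc l) (sym s≡0) h)

  -- |q n - a m| < m / Q, that is |n/m - a/q| < 1/(q Q)
  record Near (Q m n a q : ℕ) : Set where
    constructor _&_
    field
      above : Q * (a * m) < Q * (q * n) + m
      below : Q * (q * n) < Q * (a * m) + m

  near? : ∀ Q m n a q → Dec (Near Q m n a q)
  near? Q m n a q = map′ (λ (h , k) → h & k) (λ (h & k) → h , k) ((_ <? _) ×-dec (_ <? _))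

  -- A crude bound, but it makes the search for a numerator finite, so that "some numerator is near"
  -- is a decidable property of `q`.
  near-bound : ∀ {Q m a} n q .{{_ : NonZero Q}} .{{_ : NonZero m}} → Near Q m n a q → a < suc (q * n)
  near-bound {Q} {m} {a} n q (h & _) = *-cancelʳ-< m a (suc (q * n)) (*-cancelˡ-< Q _ _ (begin-strict
    Q * (a * m)              <⟨ h ⟩
    Q * (q * n) + m          ≤⟨ +-mono-≤ (*-monoʳ-≤ Q (m≤m*n (q * n) m)) (m≤n*m m Q) ⟩
    Q * (q * n * m) + Q * m  ≡⟨ solve 3 (λ Q x m → Q :* (x :* m) :+ Q :* m := Q :* ((con 1 :+ x) :* m))
        refl Q (q * n) m ⟩
    Q * (suc (q * n) * m)    ∎))
    where open ≤-Reasoning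

  -- Pigeonhole: the `Q + 1` residues of `k n` modulo `m`, for `0 ≤ k ≤ Q`, fall into `Q` boxes of
  -- width `m / Q`. Two indices in one box give `q` as their difference and `a` as the difference of
  -- the quotients.
  dirichlet : ∀ Q m n .{{_ : NonZero Q}} .{{_ : NonZero m}} →
              ∃₂ λ a q → 1 ≤ q × q ≤ Q × Near Q m n a q
  dirichlet Q m n = a , q , m<n⇒0<n∸m i<j , ≤-trans (m∸n≤m j i) (s≤s⁻¹ (Fin.toℕ<n j′)) ,
                    one-sided (boxes-meet i j box≡) eq₁ & one-sided (boxes-meet j i (sym box≡)) (sym eq₁)
    where
    remainder : ℕ → ℕ
    remainder k = k * n % m

    box : ℕ → ℕ
    box k = Q * remainder k / m

    box<Q : ∀ k → box k < Q
    box<Q k = m<n*o⇒m/o<n (*-monoʳ-< Q (m%n<n (k * n) m))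

    hole = Fin.pigeonhole (n<1+n Q) (λ k → fromℕ< (box<Q (toℕ k)))
    i′ = proj₁ hole
    j′ = proj₁ (proj₂ hole)
    i = toℕ i′
    j = toℕ j′
    i<j : i < j
    i<j = proj₁ (proj₂ (proj₂ hole))
    box≡ : box i ≡ box j
    box≡ = Fin.fromℕ<-injective _ _ (box<Q i) (box<Q j) (proj₂ (proj₂ (proj₂ hole)))

    a = j * n / m ∸ i * n / m
    q = j ∸ i

    boxes-meet : ∀ k l → box k ≡ box l → Q * remainder k < Q * remainder l + m
    boxes-meet k l eq = begin-strict
      Q * remainder k                     ≡⟨ m≡m%n+[m/n]*n (Q * remainder k) m ⟩
      Q * remainder k % m + box k * m     <⟨ +-monoˡ-< (box k * m) (m%n<n (Q * remainder k) m) ⟩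
      m + box k * m                       ≡⟨ cong (λ b → m + b * m) eq ⟩
      m + box l * m                       ≤⟨ +-monoʳ-≤ m (m/n*n≤m (Q * remainder l) m) ⟩
      m + Q * remainder l                 ≡⟨ +-comm m _ ⟩
      Q * remainder l + m                 ∎
      where open ≤-Reasoning

    eq₁ : a * m + remainder j ≡ q * n + remainder i
    eq₁ = +-cancelʳ-≡ (i * n / m * m) _ _ (begin
      a * m + remainder j + i * n / m * m
        ≡⟨ solve 4 (λ a m r s → a :* m :+ r :+ s :* m := r :+ (s :+ a) :* m) refl a m (remainder j)
            (i * n / m) ⟩
      remainder j + (i * n / m + a) * m
        ≡⟨ cong (λ x → remainder j + x * m) (m+[n∸m]≡n (/-monoˡ-≤ m (*-monoˡ-≤ n (<⇒≤ i<j)))) ⟩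
      remainder j + j * n / m * m
        ≡⟨ m≡m%n+[m/n]*n (j * n) m ⟨
      j * n
        ≡⟨ cong (_* n) (m∸n+n≡m (<⇒≤ i<j)) ⟨
      (q + i) * n
        ≡⟨ *-distribʳ-+ n q i ⟩
      q * n + i * n
        ≡⟨ cong (λ x → q * n + x) (m≡m%n+[m/n]*n (i * n) m) ⟩
      q * n + (remainder i + i * n / m * m)
        ≡⟨ +-assoc (q * n) _ _ ⟨
      q * n + remainder i + i * n / m * m
        ∎)
      where open ≡-Reasoning

    one-sided : ∀ {x y r s} → Q * r < Q * s + m → x + s ≡ y + r → Q * x < Q * y + m
    one-sided {x} {y} {r} {s} h eq = +-cancelʳ-< (Q * s) _ _ (begin-strict
      Q * x + Q * s        ≡⟨ *-distribˡ-+ Q x s ⟨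
      Q * (x + s)          ≡⟨ cong (Q *_) eq ⟩
      Q * (y + r)          ≡⟨ *-distribˡ-+ Q y r ⟩
      Q * y + Q * r        <⟨ +-monoʳ-< (Q * y) h ⟩
      Q * y + (Q * s + m)  ≡⟨ solve 3 (λ y s m → y :+ (s :+ m) := y :+ m :+ s) refl (Q * y) (Q * s) m ⟩
      Q * y + m + Q * s    ∎)
      where open ≤-Reasoning

  -- The lexicographically least near fraction `(q , a)`. Two numerators near for the same `q` both
  -- lie within `1/Q` of `q n / m`, so a tie for `a-least` to break arises only when `Q = 1`.
  record Best (Q m n : ℕ) : Set where
    field
      a q     : ℕ
      1≤q     : 1 ≤ q
      q≤Q     : q ≤ Q
      near    : Near Q m n a q
      q-least : ∀ {b r} → 1 ≤ r → Near Q m n b r → q ≤ r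
      a-least : ∀ {b} → Near Q m n b q → a ≤ b

  abstract
    best : ∀ Q m n .{{_ : NonZero Q}} .{{_ : NonZero m}} → Best Q m n
    best Q m n with dirichlet Q m n
    ... | a₀ , q₀ , 1≤q₀ , q₀≤Q , near₀
      with least {P = λ q → 1 ≤ q × ∃ λ a → a < suc (q * n) × Near Q m n a q}
             (λ q → (1 ≤? q) ×-dec anyUpTo? (λ a → near? Q m n a q) (suc (q * n)))
             q₀ (1≤q₀ , a₀ , near-bound n q₀ near₀ , near₀)
    ...   | q , (1≤q , a₁ , _ , near₁) , q-min
      with least (λ a → near? Q m n a q) a₁ near₁
    ...     | a , near , a-min = record
      { a = a ; q = q ; 1≤q = 1≤q
      ; q≤Q = ≤-trans (q-min q₀ (1≤q₀ , a₀ , near-bound n q₀ near₀ , near₀)) q₀≤Q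
      ; near = near
      ; q-least = λ {b} {r} 1≤r near′ → q-min r (1≤r , b , near-bound n r near′ , near′)
      ; a-least = λ {b} near′ → a-min b near′
      }

-- Cutting sets of lattice points into short progressions

module Tilings where
  open Combinatorics
  open import Data.Nat.Base
  open import Data.Nat.DivMod
  open import Data.Nat.Divisibility using (n∣m*n)
  open import Data.Nat.Properties
  open ≡ hiding ([_])

  private variable
    ℓ ℓ′ : Level

  record Tiling (R : Pred ℤ² ℓ) (v : ℤ²) (L : ℕ) : Set ℓ where
    field
      tiles     : List Progression
      nonempty  : ∀ {P} → P ∈ₗ tiles → Satisfiable (points P)
      contained : ∀ {P} → P ∈ₗ tiles → points P ⊆ R
      covers    : ∀ {x} → x ∈ R → ∃ λ P → P ∈ₗ tiles × x ∈ points P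
      disjoint  : ∀ {P P′ x} → P ∈ₗ tiles → P′ ∈ₗ tiles → x ∈ points P → x ∈ points P′ → P ≡ P′
      spacing   : ∀ {P} → P ∈ₗ tiles → Progression.spacing P ≡ v
      short     : ∀ {P} → P ∈ₗ tiles → Progression.len P ≤ L

  open Tiling using (tiles)

  module _ {v : ℤ²} {L : ℕ} where

    emptyTiling : {R : Pred ℤ² ℓ} → (∀ x → ¬ R x) → Tiling R v L
    emptyTiling ¬R = record
      { tiles = [] ; nonempty = λ () ; contained = λ () ; covers = λ r → ⊥-elim (¬R _ r)
      ; disjoint = λ () ; spacing = λ () ; short = λ () }

    retile : {R : Pred ℤ² ℓ} {S : Pred ℤ² ℓ′} → R ⊆ S → S ⊆ R → Tiling R v L → Tiling S v L
    retile R⊆S S⊆R T = record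
      { tiles = T.tiles ; nonempty = T.nonempty ; contained = λ P∈ x∈ → R⊆S (T.contained P∈ x∈)
      ; covers = λ x∈ → T.covers (S⊆R x∈) ; disjoint = T.disjoint ; spacing = T.spacing ; short = T.short }
      where module T = Tiling T

    join : {R : Pred ℤ² ℓ} {S : Pred ℤ² ℓ′} → (∀ {x} → R x → S x → ⊥) →
           Tiling R v L → Tiling S v L → Tiling (R ∪ S) v L
    join {R = R} {S = S} R∩S T U = record
      { tiles = T.tiles ++ U.tiles
      ; nonempty = λ P∈ → either P∈ T.nonempty U.nonempty
      ; contained = λ P∈ x∈ → either P∈ (λ P∈ → inj₁ (T.contained P∈ x∈)) (λ P∈ → inj₂ (U.contained P∈ x∈))
      ; covers = covers′
      ; disjoint = λ P∈ P′∈ x∈ x∈′ → either P∈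
          (λ P∈ → either P′∈ (λ P′∈ → T.disjoint P∈ P′∈ x∈ x∈′)
                             (λ P′∈ → ⊥-elim (R∩S (T.contained P∈ x∈) (U.contained P′∈ x∈′))))
          (λ P∈ → either P′∈ (λ P′∈ → ⊥-elim (R∩S (T.contained P′∈ x∈′) (U.contained P∈ x∈)))
                             (λ P′∈ → U.disjoint P∈ P′∈ x∈ x∈′))
      ; spacing = λ P∈ → either P∈ T.spacing U.spacing
      ; short = λ P∈ → either P∈ T.short U.short
      }
      where
      module T = Tiling T
      module U = Tiling U
      either : ∀ {P a} {A : Set a} → P ∈ₗ T.tiles ++ U.tiles → (P ∈ₗ T.tiles → A) → (P ∈ₗ U.tiles → A) → A
      either P∈ f g with ∈-++⁻ T.tiles P∈
      ... | inj₁ p = f p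
      ... | inj₂ p = g p
      covers′ : ∀ {x} → (R ∪ S) x → ∃ λ P → P ∈ₗ T.tiles ++ U.tiles × x ∈ points P
      covers′ (inj₁ r) = let P , P∈ , x∈ = T.covers r in P , ∈-++⁺ˡ P∈ , x∈
      covers′ (inj₂ s) = let P , P∈ , x∈ = U.covers s in P , ∈-++⁺ʳ T.tiles P∈ , x∈

    module _ (R : ℕ → Pred ℤ² ℓ) (apart : ∀ {j k x} → R j x → R k x → j ≡ k)
        (T : ∀ k → Tiling (R k) v L) where

      abstract
        joins : ∀ n → Tiling (λ x → ∃ λ k → k < n × R k x) v L
        joins zero    = emptyTiling λ where _ (_ , () , _)
        joins (suc n) = retile grow split (join (λ where (k , k<n , r) r′ → <⇒≢ k<n (apart r r′))
            (joins n) (T n))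
          where
          grow : (λ x → ∃ λ k → k < n × R k x) ∪ R n ⊆ (λ x → ∃ λ k → k < suc n × R k x)
          grow (inj₁ (k , k<n , r)) = k , m<n⇒m<1+n k<n , r
          grow (inj₂ r)             = n , ≤-refl , r
          split : (λ x → ∃ λ k → k < suc n × R k x) ⊆ (λ x → ∃ λ k → k < n × R k x) ∪ R n
          split (k , k<1+n , r) with m≤n⇒m<n∨m≡n (s≤s⁻¹ k<1+n)
          ... | inj₁ k<n  = inj₁ (k , k<n , r)
          ... | inj₂ refl = inj₂ r

        length-joins : ∀ n → length (tiles (joins n)) ≡ ∑< n (λ k → length (tiles (T k)))
        length-joins zero    = refl
        length-joins (suc n) = trans (length-++ (tiles (joins n)))
            (cong (λ k → k + length (tiles (T n))) (length-joins n))

  +[]-assoc : ∀ p i j v → (p +[ i ] v) +[ j ] v ≡ p +[ i + j ] v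
  +[]-assoc (x , y) i j (u , w) = cong₂ _,_ (component x u) (component y w)
    where
    component : ∀ x u → (x ℤ.+ + i ℤ.* u) ℤ.+ + j ℤ.* u ≡ x ℤ.+ + (i + j) ℤ.* u
    component x u = trans (ring x u (+ i) (+ j)) (cong (λ k → x ℤ.+ k ℤ.* u) (sym (ℤ.pos-+ i j)))
      where
      ring : ∀ x u i j → (x ℤ.+ i ℤ.* u) ℤ.+ j ℤ.* u ≡ x ℤ.+ (i ℤ.+ j) ℤ.* u
      ring = ℤSolver.solve-∀

  module _ {v : ℤ²} (L : ℕ) .{{_ : NonZero L}} {R : Pred ℤ² ℓ} (base : ℤ²)
    (injective : ∀ {i j} → base +[ i ] v ≡ base +[ j ] v → i ≡ j)
    (R? : ∀ i → Dec (R (base +[ i ] v)))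
    (convex : ∀ {i j k} → i ≤ j → j ≤ k → R (base +[ i ] v) → R (base +[ k ] v) → R (base +[ j ] v))
    (B : ℕ) (on-ray : ∀ {x} → R x → ∃ λ i → i < B × x ≡ base +[ i ] v)
    where

    private
      bound : ∀ {i} → R (base +[ i ] v) → i < B
      bound r = let j , j<B , eq = on-ray r in subst (_< B) (sym (injective eq)) j<B

      position : ∀ {j r} → r < L → (r + j * L) / L ≡ j
      position {j} {r} r<L = begin
        (r + j * L) / L      ≡⟨ +-distrib-/-∣ʳ r (n∣m*n j) ⟩
        r / L + j * L / L    ≡⟨ cong₂ _+_ (m<n⇒m/n≡0 r<L) (m*n/n≡m j L) ⟩
        j                    ∎
        where open ≡-Reasoning

    -- If the run of R along the ray is cut into e + 1 blocks, then R contains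
    -- two points e L steps apart.
    ray-tiling : Σ[ T ∈ Tiling R v L ] (length (tiles T) ≡ 0 ⊎
      ∃₂ λ e i → length (tiles T) ≡ suc e × R (base +[ i ] v) × R (base +[ i + e * L ] v))
    ray-tiling with convex-interval R? convex B bound
    ... | s , zero , inside , _ = emptyTiling ¬R , inj₁ refl
      where
      ¬R : ∀ x → ¬ R x
      ¬R x r with on-ray r
      ... | i , _ , refl = <⇒≱ (proj₂ (inside {i} r))
          (≤-trans (≤-reflexive (+-identityʳ s)) (proj₁ (inside {i} r)))
    ... | s , suc l , inside , isR = T , inj₂ (l / L , s , count , isR ≤-refl (m<m+n s (s≤s z≤n)) , far)
      where
      -- The run has `suc l` points, so it takes `l / L + 1` chunks, and only the last can be
      -- truncated. The first points of the first and last chunks are `l / L * L` steps apart, which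
      -- is what the counting uses.
      chunk : ℕ → Progression
      chunk j = progression (base +[ s + j * L ] v) v (L ⊓ (suc l ∸ j * L))

      chunks : List Progression
      chunks = map chunk (upTo (suc (l / L)))

      count : length chunks ≡ suc (l / L)
      count = trans (length-map chunk (upTo (suc (l / L)))) (length-upTo (suc (l / L)))

      far : R (base +[ s + l / L * L ] v)
      far = isR (m≤m+n s _) (+-monoʳ-< s (s≤s (m/n*n≤m l L)))

      unchunk : ∀ {P} → P ∈ₗ chunks → ∃ λ j → j ≤ l / L × P ≡ chunk j
      unchunk P∈ = let j , j∈ , eq = ∈-map⁻ chunk P∈ in j , s≤s⁻¹ (∈-upTo⁻ j∈) , eq

      shift : ∀ j r → (base +[ s + j * L ] v) +[ r ] v ≡ base +[ s + (r + j * L) ] v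
      shift j r = trans (+[]-assoc base (s + j * L) r v)
        (cong (λ i → base +[ i ] v) (trans (+-assoc s (j * L) r) (cong (λ k → s + k) (+-comm (j * L) r))))

      nonempty′ : ∀ {P} → P ∈ₗ chunks → Satisfiable (points P)
      nonempty′ P∈ with unchunk P∈
      ... | j , j≤ , refl = _ , 0 , ⊓-glb (>-nonZero⁻¹ L)
          (m<n⇒0<n∸m (s≤s (≤-trans (*-monoˡ-≤ L j≤) (m/n*n≤m l L)))) , refl

      contained′ : ∀ {P} → P ∈ₗ chunks → points P ⊆ R
      contained′ P∈ (r , r< , refl) with unchunk P∈
      ... | j , _ , refl = subst R (sym (shift j r)) (isR (m≤m+n s _)
          (+-monoʳ-< s (m≤n∸o⇒m+o≤n′ (≤-trans r< (m⊓n≤n L _)))))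
        where
        m≤n∸o⇒m+o≤n′ : suc r ≤ suc l ∸ j * L → suc (r + j * L) ≤ suc l
        m≤n∸o⇒m+o≤n′ h = m≤o∸n⇒m+n≤o (suc r) (<⇒≤ (m∸n≢0⇒n<m λ eq → n≮0 (≤-trans h (≤-reflexive eq)))) h

      covers′ : ∀ {x} → x ∈ R → ∃ λ P → P ∈ₗ chunks × x ∈ points P
      covers′ rx with on-ray rx
      ... | i , _ , refl = chunk j , ∈-map⁺ chunk (∈-upTo⁺ (s≤s (/-monoˡ-≤ L (s≤s⁻¹ d<))))
                         , d % L
                         , ⊓-glb (m%n<n d L) (m+n≤o⇒m≤o∸n (suc (d % L))
                             (≤-trans (≤-reflexive (cong suc (sym d≡))) d<))
                         , trans (cong (λ i → base +[ i ] v)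
                             (sym (trans (cong (λ k → s + k) (sym d≡)) (m+[n∸m]≡n s≤i))))
                                 (sym (shift j (d % L)))
        where
        s≤i = proj₁ (inside rx)
        d = i ∸ s
        j = d / L
        d≡ : d ≡ d % L + j * L
        d≡ = m≡m%n+[m/n]*n d L
        d< : d < suc l
        d< = +-cancelˡ-< s d (suc l) (≤-trans (≤-reflexive (cong suc (m+[n∸m]≡n s≤i))) (proj₂ (inside rx)))

      disjoint′ : ∀ {P P′ x} → P ∈ₗ chunks → P′ ∈ₗ chunks → x ∈ points P → x ∈ points P′ → P ≡ P′
      disjoint′ P∈ P′∈ (r , r< , eq) (r′ , r′< , eq′) with unchunk P∈ | unchunk P′∈
      ... | j , _ , refl | j′ , _ , refl = cong chunk (begin
        j                    ≡⟨ position (≤-trans r< (m⊓n≤m L _)) ⟨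
        (r + j * L) / L      ≡⟨ cong (_/ L) (+-cancelˡ-≡ s _ _ (injective
                                  (trans (sym (shift j r)) (trans (sym eq) (trans eq′ (shift j′ r′)))))) ⟩
        (r′ + j′ * L) / L    ≡⟨ position (≤-trans r′< (m⊓n≤m L _)) ⟩
        j′                   ∎)
        where open ≡-Reasoning

      T : Tiling R v L
      T = record
        { tiles = chunks ; nonempty = nonempty′ ; contained = contained′ ; covers = covers′ ; disjoint =
            disjoint′
        ; spacing = λ P∈ → let _ , _ , eq = unchunk P∈ in cong Progression.spacing eq
        ; short = λ P∈ → let _ , _ , eq = unchunk P∈ in
            ≤-trans (≤-reflexive (cong Progression.len eq)) (m⊓n≤m L _)
        }

open Combinatorics
open Tilings

-- Ordered field arithmetic and certificates for inequalities

module OrderedField {c ℓ₁ ℓ₂} (ℝ : RealField c ℓ₁ ℓ₂) where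
  open RealField ℝ
  open Algebra.Properties.Ring ring using (-0#≈0#; -‿involutive; -‿distribˡ-*; -‿distribʳ-*)
  open Algebra.Properties.Semiring.Mult semiring using (×-homo-+; ×1-homo-*)
  open Relation.Binary.Reasoning.Setoid setoid
  private module < = IsStrictTotalOrder isStrictTotalOrder
  private module ≤ = Relation.Binary.Construct.StrictToNonStrict _≈_ _<_

  <-trans : ∀ {x y z} → x < y → y < z → x < z
  <-trans = <.trans

  <-irrefl : ∀ {x} → ¬ (x < x)
  <-irrefl = <.irrefl refl

  ≤-refl : ∀ {x} → x ≤ x
  ≤-refl = inj₂ refl

  ≤-trans : ∀ {x y z} → x ≤ y → y ≤ z → x ≤ z
  ≤-trans = ≤.trans isEquivalence <.<-resp-≈ <.trans

  <-≤-trans : ∀ {x y z} → x < y → y ≤ z → x < z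
  <-≤-trans = ≤.<-≤-trans <.trans <.<-respʳ-≈

  ≤-<-trans : ∀ {x y z} → x ≤ y → y < z → x < z
  ≤-<-trans = ≤.≤-<-trans sym <.trans <.<-respˡ-≈

  ≤-resp-≈ : ∀ {x x′ y y′} → x ≈ x′ → y ≈ y′ → x ≤ y → x′ ≤ y′
  ≤-resp-≈ p q h = ≤-trans (inj₂ (sym p)) (≤-trans h (inj₂ q))

  <-resp-≈ : ∀ {x x′ y y′} → x ≈ x′ → y ≈ y′ → x < y → x′ < y′
  <-resp-≈ p q h = ≤-<-trans (inj₂ (sym p)) (<-≤-trans h (inj₂ q))

  ≤⇒≯ : ∀ {x y} → x ≤ y → ¬ (y < x)
  ≤⇒≯ h k = <-irrefl (≤-<-trans h k)

  ≮⇒≥ : ∀ {x y} → ¬ (x < y) → y ≤ x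
  ≮⇒≥ {x} {y} h with <.compare x y
  ... | tri< p _ _ = ⊥-elim (h p)
  ... | tri≈ _ p _ = inj₂ (sym p)
  ... | tri> _ _ p = inj₁ p

  ≤-or-> : ∀ x y → (x ≤ y) ⊎ (y < x)
  ≤-or-> x y with <.compare x y
  ... | tri< p _ _ = inj₁ (inj₁ p)
  ... | tri≈ _ p _ = inj₁ (inj₂ p)
  ... | tri> _ _ p = inj₂ p

  _<?_ : ∀ x y → Dec (x < y)
  _<?_ = <._<?_

  _≤?_ : ∀ x y → Dec (x ≤ y)
  _≤?_ = ≤.decidable′ <.compare

  fromℕ-+ : ∀ m n → fromℕ (m ℕ.+ n) ≈ fromℕ m + fromℕ n
  fromℕ-+ = ×-homo-+ 1#

  fromℕ-* : ∀ m n → fromℕ (m ℕ.* n) ≈ fromℕ m * fromℕ n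
  fromℕ-* = ×1-homo-*

  fromℤ-neg : ∀ i → fromℤ (ℤ.- i) ≈ - fromℤ i
  fromℤ-neg (+ zero)  = sym -0#≈0#
  fromℤ-neg (+ suc n) = refl
  fromℤ-neg -[1+ n ]  = sym (-‿involutive _)

  private
    fromℤ-⊖ : ∀ m n → fromℤ (m ℤ.⊖ n) ≈ fromℕ m + - fromℕ n
    fromℤ-⊖ m zero = begin
      fromℕ m           ≈⟨ +-identityʳ _ ⟨
      fromℕ m + 0#      ≈⟨ +-congˡ -0#≈0# ⟨
      fromℕ m + - 0#    ∎
    fromℤ-⊖ zero (suc n) = sym (+-identityˡ _)
    fromℤ-⊖ (suc m) (suc n) = begin
      fromℤ (suc m ℤ.⊖ suc n)               ≡⟨ ≡.cong fromℤ (ℤ.[1+m]⊖[1+n]≡m⊖n m n) ⟩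
      fromℤ (m ℤ.⊖ n)                       ≈⟨ fromℤ-⊖ m n ⟩
      fromℕ m + - fromℕ n                   ≈⟨ shift (fromℕ m) (fromℕ n) ⟩
      (1# + fromℕ m) + - (1# + fromℕ n)     ∎
      where
      open import Algebra.Properties.AbelianGroup +-abelianGroup using (⁻¹-∙-comm; xyx⁻¹≈y)
      shift : ∀ x y → x + - y ≈ (1# + x) + - (1# + y)
      shift x y = sym (begin
        (1# + x) + - (1# + y)    ≈⟨ +-congˡ (⁻¹-∙-comm 1# y) ⟨
        (1# + x) + (- 1# + - y)  ≈⟨ +-assoc (1# + x) (- 1#) (- y) ⟨
        ((1# + x) + - 1#) + - y  ≈⟨ +-congʳ (xyx⁻¹≈y 1# x) ⟩
        x + - y                  ∎)

  fromℤ-+ : ∀ i j → fromℤ (i ℤ.+ j) ≈ fromℤ i + fromℤ j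
  fromℤ-+ (+ m) (+ n) = fromℕ-+ m n
  fromℤ-+ (+ m) -[1+ n ] = fromℤ-⊖ m (suc n)
  fromℤ-+ -[1+ m ] (+ n) = trans (fromℤ-⊖ n (suc m)) (+-comm _ _)
  fromℤ-+ -[1+ m ] -[1+ n ] = begin
    fromℤ (-[1+ m ] ℤ.+ -[1+ n ])            ≡⟨ ≡.cong fromℤ (ℤ.neg-distrib-+ (+ suc m) (+ suc n)) ⟨
    fromℤ (ℤ.- (+ suc m ℤ.+ + suc n))        ≈⟨ fromℤ-neg (+ suc m ℤ.+ + suc n) ⟩
    - fromℕ (suc m ℕ.+ suc n)                ≈⟨ -‿cong (fromℕ-+ (suc m) (suc n)) ⟩
    - (fromℕ (suc m) + fromℕ (suc n))        ≈⟨ ⁻¹-∙-comm _ _ ⟨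
    - fromℕ (suc m) + - fromℕ (suc n)        ∎
    where open import Algebra.Properties.AbelianGroup +-abelianGroup using (⁻¹-∙-comm)

  private
    fromℤ-*⁺ : ∀ m n → fromℤ (+ m ℤ.* + n) ≈ fromℕ m * fromℕ n
    fromℤ-*⁺ m n = trans (reflexive (≡.cong fromℤ (≡.sym (ℤ.pos-* m n)))) (fromℕ-* m n)

    fromℤ-*ʳ : ∀ m j → fromℤ (+ m ℤ.* j) ≈ fromℕ m * fromℤ j
    fromℤ-*ʳ m (+ n) = fromℤ-*⁺ m n
    fromℤ-*ʳ m -[1+ n ] = begin
      fromℤ (+ m ℤ.* -[1+ n ])       ≡⟨ ≡.cong fromℤ (ℤ.neg-distribʳ-* (+ m) (+ suc n)) ⟨
      fromℤ (ℤ.- (+ m ℤ.* + suc n))  ≈⟨ fromℤ-neg (+ m ℤ.* + suc n) ⟩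
      - fromℤ (+ m ℤ.* + suc n)      ≈⟨ -‿cong (fromℤ-*⁺ m (suc n)) ⟩
      - (fromℕ m * fromℕ (suc n))    ≈⟨ -‿distribʳ-* _ _ ⟩
      fromℕ m * - fromℕ (suc n)      ∎

  fromℤ-* : ∀ i j → fromℤ (i ℤ.* j) ≈ fromℤ i * fromℤ j
  fromℤ-* (+ m) j = fromℤ-*ʳ m j
  fromℤ-* -[1+ m ] j = begin
    fromℤ (-[1+ m ] ℤ.* j)        ≡⟨ ≡.cong fromℤ (ℤ.neg-distribˡ-* (+ suc m) j) ⟨
    fromℤ (ℤ.- (+ suc m ℤ.* j))   ≈⟨ fromℤ-neg (+ suc m ℤ.* j) ⟩
    - fromℤ (+ suc m ℤ.* j)       ≈⟨ -‿cong (fromℤ-*ʳ (suc m) j) ⟩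
    - (fromℕ (suc m) * fromℤ j)   ≈⟨ -‿distribˡ-* _ _ ⟩
    - fromℕ (suc m) * fromℤ j     ∎

  fromℤ-1 : fromℤ 1ℤ ≈ 1#
  fromℤ-1 = +-identityʳ 1#

  private
    coefficient≟ : ∀ i j → Maybe (fromℤ i ≈ fromℤ j)
    coefficient≟ i j with i ℤ.≟ j
    ... | yes i≡j = just (reflexive (≡.cong fromℤ i≡j))
    ... | no _    = nothing

  private
    -- Integer coefficients let the solver compute with numerals. Its constant `con (+ k)` evaluates
    -- to `fromℕ k` by definition, which is why numerals, 1 included, are written `fromℕ k` in the
    -- estimates.
    coefficients : ℤ.+-*-rawRing -Raw-AlmostCommutative⟶ fromCommutativeRing commutativeRing
    coefficients = record
      { ⟦_⟧    = fromℤ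
      ; +-homo = fromℤ-+
      ; *-homo = fromℤ-*
      ; -‿homo = fromℤ-neg
      ; 0-homo = refl
      ; 1-homo = fromℤ-1
      }

  module Solver =
    Algebra.Solver.Ring ℤ.+-*-rawRing (fromCommutativeRing commutativeRing) coefficients coefficient≟

  open Solver using (solve; _:+_; _:*_; _:-_; _:=_; con)

  private
    +-mono-< : ∀ {x y} z → x < y → z + x < z + y
    +-mono-< z h = <-resp-≈ (+-comm _ _) (+-comm _ _) (+-monoˡ-< z h)

  diff< : ∀ {x y} → x < y → 0# < y - x
  diff< {x} h = <-resp-≈ (-‿inverseʳ x) refl (+-monoˡ-< (- x) h)

  diff≤ : ∀ {x y} → x ≤ y → 0# ≤ y - x
  diff≤ (inj₁ h) = inj₁ (diff< h)
  diff≤ {x} (inj₂ h) = inj₂ (trans (sym (-‿inverseʳ x)) (+-congʳ h))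

  -- An inequality x < y is certified by writing y - x as a combination of
  -- products of positive terms; the identity is left to the ring solver.
  by< : ∀ {x y e} → 0# < e → y - x ≈ e → x < y
  by< {x} {y} h p =
    <-resp-≈ (+-identityʳ x) (solve 2 (λ x y → x :+ (y :- x) := y) refl x y)
      (+-mono-< x (<-resp-≈ refl (sym p) h))

  by≤ : ∀ {x y e} → 0# ≤ e → y - x ≈ e → x ≤ y
  by≤ (inj₁ h) p = inj₁ (by< h p)
  by≤ {x} {y} (inj₂ h) p = inj₂ (begin
    x            ≈⟨ +-identityʳ x ⟨
    x + 0#       ≈⟨ +-congˡ (trans h (sym p)) ⟩
    x + (y - x)  ≈⟨ solve 2 (λ x y → x :+ (y :- x) := y) refl x y ⟩
    y            ∎)

  infixl 6 _⊕_ _⊞_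
  infixl 7 _⊗_ _⊠_

  _⊗_ : ∀ {x y} → 0# ≤ x → 0# ≤ y → 0# ≤ x * y
  inj₁ p ⊗ inj₁ q = inj₁ (*-pos p q)
  inj₁ p ⊗ inj₂ q = inj₂ (trans (sym (zeroʳ _)) (*-congˡ q))
  inj₂ p ⊗ q      = inj₂ (trans (sym (zeroˡ _)) (*-congʳ p))

  _⊠_ : ∀ {x y} → 0# < x → 0# < y → 0# < x * y
  _⊠_ = *-pos

  _⊕_ : ∀ {x y} → 0# ≤ x → 0# ≤ y → 0# ≤ x + y
  inj₁ p ⊕ inj₁ q = inj₁ (<-resp-≈ (+-identityʳ 0#) refl (<-trans (+-monoˡ-< 0# p) (+-mono-< _ q)))
  inj₁ p ⊕ inj₂ q = inj₁ (<-≤-trans p (inj₂ (trans (sym (+-identityʳ _)) (+-congˡ q))))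
  inj₂ p ⊕ q      = ≤-trans q (inj₂ (trans (sym (+-identityˡ _)) (+-congʳ p)))

  _⊞_ : ∀ {x y} → 0# < x → 0# ≤ y → 0# < x + y
  p ⊞ inj₁ q = <-resp-≈ (+-identityʳ 0#) refl (<-trans (+-monoˡ-< 0# p) (+-mono-< _ q))
  p ⊞ inj₂ q = <-≤-trans p (inj₂ (trans (sym (+-identityʳ _)) (+-congˡ q)))

  <⇒≤ : ∀ {x y} → x < y → x ≤ y
  <⇒≤ = inj₁

  sq-nonneg : ∀ x → 0# ≤ x * x
  sq-nonneg x with ≤-or-> 0# x
  ... | inj₁ p = p ⊗ p
  ... | inj₂ p = ≤-trans (k ⊗ k) (inj₂ (solve 1 (λ x → (con (+ 0) :- x) :* (con (+ 0) :- x) := x :* x)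
      refl x))
    where k = <⇒≤ (diff< p)

  fromℕ-nonneg : ∀ n → 0# ≤ fromℕ n
  fromℕ-nonneg zero    = ≤-refl
  fromℕ-nonneg (suc n) = inj₁ 0<1 ⊕ fromℕ-nonneg n

  fromℕ-pos : ∀ n → 0# < fromℕ (suc n)
  fromℕ-pos n = 0<1 ⊞ fromℕ-nonneg n

  <-cancelˡ : ∀ {x y z} → 0# ≤ z → z * x < z * y → x < y
  <-cancelˡ {x} {y} {z} hz h with ≤-or-> y x
  ... | inj₂ p = p
  ... | inj₁ p = ⊥-elim (≤⇒≯ (by≤ (hz ⊗ diff≤ p)
                   (solve 3 (λ x y z → z :* x :- z :* y := z :* (x :- y)) refl x y z)) h)

  ≤-cancelˡ : ∀ {x y z} → 0# < z → z * x ≤ z * y → x ≤ y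
  ≤-cancelˡ {x} {y} {z} hz h = ≮⇒≥ λ p → ≤⇒≯ h
    (by< (hz ⊠ diff< p) (solve 3 (λ x y z → z :* x :- z :* y := z :* (x :- y)) refl x y z))

  *-mono-≤ : ∀ {x x′ y y′} → 0# ≤ x → 0# ≤ y → x ≤ x′ → y ≤ y′ → x * y ≤ x′ * y′
  *-mono-≤ {x} {x′} {y} {y′} hx hy p q =
    by≤ (diff≤ p ⊗ (hy ⊕ diff≤ q) ⊕ hx ⊗ diff≤ q)
      (solve 4 (λ x x′ y y′ → x′ :* y′ :- x :* y
                := (x′ :- x) :* (y :+ (y′ :- y)) :+ x :* (y′ :- y)) refl x x′ y y′)

  ≤-sq⁻ : ∀ {x y} → 0# ≤ y → x * x ≤ y * y → x ≤ y
  ≤-sq⁻ {x} {y} hy h = ≮⇒≥ λ p → ≤⇒≯ h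
    (by< (diff< p ⊠ (diff< p ⊞ (hy ⊕ hy)))
      (solve 2 (λ x y → x :* x :- y :* y := (x :- y) :* ((x :- y) :+ (y :+ y))) refl x y))

  fromℤ-nonneg : ∀ {i} → + 0 ℤ.≤ i → 0# ≤ fromℤ i
  fromℤ-nonneg {+ n} _ = fromℕ-nonneg n

  fromℤ-pos : ∀ {i} → + 0 ℤ.< i → 0# < fromℤ i
  fromℤ-pos {+ suc n} _ = fromℕ-pos n
  fromℤ-pos {+ zero} (ℤ.+<+ ())

  fromℤ-sub : ∀ i j → fromℤ (i ℤ.- j) ≈ fromℤ i - fromℤ j
  fromℤ-sub i j = trans (fromℤ-+ i (ℤ.- j)) (+-congˡ (fromℤ-neg j))

  fromℤ-mono-≤ : ∀ {i j} → i ℤ.≤ j → fromℤ i ≤ fromℤ j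
  fromℤ-mono-≤ {i} {j} h = by≤ (fromℤ-nonneg (ℤ.i≤j⇒0≤j-i h)) (sym (fromℤ-sub j i))

  fromℤ-mono-< : ∀ {i j} → i ℤ.< j → fromℤ i < fromℤ j
  fromℤ-mono-< {i} {j} h = by< (fromℤ-pos (ℤ.≤∧≢⇒< (ℤ.i≤j⇒0≤j-i (ℤ.<⇒≤ h)) λ e → ℤ.<-irrefl
      (≡.sym (ℤ.i-j≡0⇒i≡j j i (≡.sym e))) h)) (sym (fromℤ-sub j i))

  fromℤ-cancel-< : ∀ {i j} → fromℤ i < fromℤ j → i ℤ.< j
  fromℤ-cancel-< {i} {j} h with i ℤ.<? j
  ... | yes p = p
  ... | no p = ⊥-elim (≤⇒≯ (fromℤ-mono-≤ (ℤ.≮⇒≥ p)) h)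

  fromℤ-cancel-≤ : ∀ {i j} → fromℤ i ≤ fromℤ j → i ℤ.≤ j
  fromℤ-cancel-≤ {i} {j} h with i ℤ.≤? j
  ... | yes p = p
  ... | no p = ⊥-elim (≤⇒≯ h (fromℤ-mono-< (ℤ.≰⇒> p)))

  fromℕ-mono-≤ : ∀ {i j} → i ℕ.≤ j → fromℕ i ≤ fromℕ j
  fromℕ-mono-≤ h = fromℤ-mono-≤ (ℤ.+≤+ h)

  fromℕ-mono-< : ∀ {i j} → i ℕ.< j → fromℕ i < fromℕ j
  fromℕ-mono-< h = fromℤ-mono-< (ℤ.+<+ h)

  fromℕ-cancel-< : ∀ {i j} → fromℕ i < fromℕ j → i ℕ.< j
  fromℕ-cancel-< {i} {j} h with fromℤ-cancel-< {+ i} {+ j} h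
  ... | ℤ.+<+ p = p

  abstract
    floor : ∀ {x} → 0# ≤ x → ∃ λ n → fromℕ n ≤ x × x < fromℕ (suc n)
    floor {x} hx with archimedean x
    ... | N , h = search N h
      where
      search : ∀ n → x < fromℕ n → ∃ λ n → fromℕ n ≤ x × x < fromℕ (suc n)
      search zero h = ⊥-elim (≤⇒≯ hx h)
      search (suc n) h with ≤-or-> (fromℕ n) x
      ... | inj₁ p = n , p , h
      ... | inj₂ p = search n p

-- Inequalities behind the range of a, the number of lines and the length of runs

module Estimates {c ℓ₁ ℓ₂} (ℝ : RealField c ℓ₁ ℓ₂) where
  open RealField ℝ
  open OrderedField ℝ
  open Solver using (solve; _:+_; _:*_; _:-_; _:=_; con)

  1≤⇒0< : ∀ {x} → 1# ≤ x → 0# < x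
  1≤⇒0< h = <-≤-trans 0<1 h

  2ₙ 3ₙ 4ₙ 8ₙ 16ₙ 32ₙ : Carrier
  2ₙ = fromℕ 2
  3ₙ = fromℕ 3
  4ₙ = fromℕ 4
  8ₙ = fromℕ 8
  16ₙ = fromℕ 16
  32ₙ = fromℕ 32

  -- 8 V + 2 blocks suffice, where V is at most the inner factor times U
  constant : Carrier → Carrier
  constant D = 8ₙ * (32ₙ + (4ₙ * (3ₙ + D) + K * K)) + 2ₙ
    where K = 16ₙ * (D + fromℕ 1)

  module _ {X H M D : Carrier} (0<X : 0# < X) (0<H : 0# < H) (0<M : 0# < M) (0<D : 0# < D) (H≤X : H ≤ X)
           (M²≤DX : M * M ≤ D * X) {Q : Carrier} (1≤Q : fromℕ 1 ≤ Q) where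

    private
      0<Q : 0# < Q
      0<Q = <-≤-trans (fromℕ-pos 0) 1≤Q

    module _ {m n a q : Carrier} (M≤m : M ≤ m) (m≤2M : m ≤ 2ₙ * M) (nm≤ : n * m ≤ X + H)
             (0≤a : 0# ≤ a) (1≤q : fromℕ 1 ≤ q) (fine : 8ₙ * (M * M) ≤ Q * X) where
      private
        0≤m = ≤-trans (<⇒≤ 0<M) M≤m
        0≤q = ≤-trans (fromℕ-nonneg 1) 1≤q

      -- Multiply the closeness condition by `m` and use `m ≥ M` on the left, `n m ≤ X + H ≤ 2 X`
      -- and `m² ≤ 4 M² ≤ Q X / 2` on the right; this is covered by the 3. The summand `D`
      -- accommodates the fraction 1/1 of the coarse case, where `M² ≤ D X`.
      fine-upper : Q * (a * m) ≤ Q * (q * n) + m → a * (M * M) ≤ (3ₙ + D) * (X * q)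
      fine-upper near = ≤-cancelˡ 0<Q (by≤
        (<⇒≤ 0<Q ⊗ 0≤a ⊗ diff≤ M≤m ⊗ (0≤m ⊕ <⇒≤ 0<M) ⊕ 0≤m ⊗ diff≤ near
          ⊕ <⇒≤ 0<Q ⊗ 0≤q ⊗ (diff≤ nm≤ ⊕ diff≤ H≤X)
          ⊕ diff≤ m≤2M ⊗ (fromℕ-nonneg 2 ⊗ <⇒≤ 0<M ⊕ 0≤m)
          ⊕ <⇒≤ 0<Q ⊗ <⇒≤ 0<X ⊗ diff≤ 1≤q ⊕ diff≤ fine ⊕ fromℕ-nonneg 4 ⊗ sq-nonneg M
          ⊕ <⇒≤ 0<Q ⊗ <⇒≤ 0<D ⊗ <⇒≤ 0<X ⊗ 0≤q)
        (solve 9 (λ X H M D Q m n a q →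
          Q :* ((con (+ 3) :+ D) :* (X :* q)) :- Q :* (a :* (M :* M))
          := Q :* a :* (m :- M) :* (m :+ M) :+ m :* (Q :* (q :* n) :+ m :- Q :* (a :* m))
             :+ Q :* q :* ((X :+ H :- n :* m) :+ (X :- H))
             :+ (con (+ 2) :* M :- m) :* (con (+ 2) :* M :+ m)
             :+ Q :* X :* (q :- con (+ 1)) :+ (Q :* X :- con (+ 8) :* (M :* M)) :+ con (+ 4) :* (M :* M)
             :+ Q :* D :* X :* q) refl X H M D Q m n a q))

      -- After multiplication by `m` the error `m²` is at most `4 M² ≤ Q X / 2`, hence at most half
      -- of `Q q X`, and is absorbed on the left. The 8 in `fine` is chosen for this. In particular
      -- `a = 0` is excluded.
      fine-lower : X ≤ n * m → Q * (q * n) ≤ Q * (a * m) + m → X * q ≤ 16ₙ * (a * (M * M))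
      fine-lower X≤nm near = ≤-cancelˡ 0<Q (by≤
        (fromℕ-nonneg 2 ⊗ <⇒≤ 0<Q ⊗ 0≤q ⊗ diff≤ X≤nm ⊕ fromℕ-nonneg 2 ⊗ 0≤m ⊗ diff≤ near
          ⊕ fromℕ-nonneg 2 ⊗ (<⇒≤ 0<Q ⊗ 0≤a ⊕ fromℕ-nonneg 1) ⊗ diff≤ m≤2M ⊗
              (fromℕ-nonneg 2 ⊗ <⇒≤ 0<M ⊕ 0≤m)
          ⊕ diff≤ fine ⊕ <⇒≤ 0<Q ⊗ <⇒≤ 0<X ⊗ diff≤ 1≤q
          ⊕ fromℕ-nonneg 8 ⊗ <⇒≤ 0<Q ⊗ 0≤a ⊗ sq-nonneg M)
        (solve 7 (λ X M Q m n a q →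
          Q :* (con (+ 16) :* (a :* (M :* M))) :- Q :* (X :* q)
          := con (+ 2) :* Q :* q :* (n :* m :- X) :+ con (+ 2) :* m :* (Q :* (a :* m) :+ m :- Q :* (q :* n))
             :+ con (+ 2) :* (Q :* a :+ con (+ 1)) :* (con (+ 2) :* M :- m) :* (con (+ 2) :* M :+ m)
             :+ (Q :* X :- con (+ 8) :* (M :* M)) :+ Q :* X :* (q :- con (+ 1))
             :+ con (+ 8) :* Q :* a :* (M :* M)) refl X M Q m n a q))

    module _ (coarse : Q * X ≤ 8ₙ * (M * M)) where

      coarse-Q : Q ≤ 8ₙ * D
      coarse-Q = ≤-cancelˡ 0<X (by≤ (fromℕ-nonneg 8 ⊗ diff≤ M²≤DX ⊕ diff≤ coarse)
        (solve 4 (λ X M D Q → X :* (con (+ 8) :* D) :- X :* Q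
          := con (+ 8) :* (D :* X :- M :* M) :+ (con (+ 8) :* (M :* M) :- Q :* X)) refl X M D Q))

      coarse-lower : X ≤ 16ₙ * (M * M)
      coarse-lower = by≤ (diff≤ coarse ⊕ <⇒≤ 0<X ⊗ diff≤ 1≤Q ⊕ fromℕ-nonneg 8 ⊗ sq-nonneg M)
        (solve 3 (λ X M Q → con (+ 16) :* (M :* M) :- X
          := (con (+ 8) :* (M :* M) :- Q :* X) :+ X :* (Q :- con (+ 1)) :+ con (+ 8) :* (M :* M)) refl X
              M Q)

      module _ {m n : Carrier} (M≤m : M ≤ m) (m≤2M : m ≤ 2ₙ * M) (0≤n : 0# ≤ n) (nm≤ : n * m ≤ X + H) where
        private
          0≤m = ≤-trans (<⇒≤ 0<M) M≤m

          mQ≤ : m * Q ≤ 16ₙ * D * M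
          mQ≤ = by≤ (diff≤ coarse-Q ⊗ 0≤m ⊕ fromℕ-nonneg 8 ⊗ <⇒≤ 0<D ⊗ diff≤ m≤2M)
            (solve 4 (λ M D Q m → con (+ 16) :* D :* M :- m :* Q
              := (con (+ 8) :* D :- Q) :* m :+ con (+ 8) :* D :* (con (+ 2) :* M :- m)) refl M D Q m)

          nQ≤ : n * Q ≤ 16ₙ * M
          nQ≤ = ≤-cancelˡ 0<M (by≤ (0≤n ⊗ <⇒≤ 0<Q ⊗ diff≤ M≤m ⊕ <⇒≤ 0<Q ⊗ diff≤ nm≤ ⊕ <⇒≤ 0<Q ⊗ diff≤ H≤X
              ⊕ fromℕ-nonneg 2 ⊗ diff≤ coarse)
            (solve 6 (λ X H M Q m n → M :* (con (+ 16) :* M) :- M :* (n :* Q)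
              := n :* Q :* (m :- M) :+ Q :* (X :+ H :- n :* m) :+ Q :* (X :- H)
                 :+ con (+ 2) :* (con (+ 8) :* (M :* M) :- Q :* X)) refl X H M Q m n))

        -- For 1/1 the deviation is `m - n`, and the two terms are bounded separately:
        -- `m Q ≤ 2 M · 8 D`, and `n Q ≤ 16 M` because `n M ≤ 2 X` and `Q X ≤ 8 M²`. Their sum is
        -- where `K` comes from. The certificate is the factorisation of a difference of squares.
        coarse-d : let K = 16ₙ * (D + fromℕ 1) ; d = m - n in
          d * Q * (d * Q) ≤ K * M * (K * M)
        coarse-d = by≤ ((diff≤ mQ≤ ⊕ fromℕ-nonneg 16 ⊗ <⇒≤ 0<M ⊕ 0≤n ⊗ <⇒≤ 0<Q) ⊗
            (diff≤ nQ≤ ⊕ fromℕ-nonneg 16 ⊗ <⇒≤ 0<D ⊗ <⇒≤ 0<M ⊕ 0≤m ⊗ <⇒≤ 0<Q))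
          (solve 5 (λ M D Q m n →
            let K = con (+ 16) :* (D :+ con (+ 1)) ; d = m :- n in
            K :* M :* (K :* M) :- d :* Q :* (d :* Q)
            := (con (+ 16) :* D :* M :- m :* Q :+ con (+ 16) :* M :+ n :* Q)
               :* (con (+ 16) :* M :- n :* Q :+ con (+ 16) :* D :* M :+ m :* Q)) refl M D Q m n)

    -- With `x = a m` and `y = q n`, closeness says `|d| Q ≤ m ≤ 2 M`, well below `K M`. The product
    -- of the two one-sided conditions is `m² - (d Q)²`; the rest is `(K M)² - m²`, with `slack`
    -- equal to `K M - 2 M`.
    fine-d : ∀ {m x y} → m ≤ 2ₙ * M → 0# ≤ m → Q * x ≤ Q * y + m → Q * y ≤ Q * x + m →
             let K = 16ₙ * (D + fromℕ 1) ; d = x - y in d * Q * (d * Q) ≤ K * M * (K * M)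
    fine-d {m} {x} {y} m≤2M 0≤m p q = by≤
      (diff≤ p ⊗ diff≤ q
        ⊕ (slack ⊕ diff≤ m≤2M) ⊗ (slack ⊕ fromℕ-nonneg 2 ⊗ <⇒≤ 0<M ⊕ 0≤m))
      (solve 6 (λ M D Q m x y →
        let K = con (+ 16) :* (D :+ con (+ 1)) ; d = x :- y ; s = con (+ 14) :* M :+ con (+ 16) :* D :* M in
        K :* M :* (K :* M) :- d :* Q :* (d :* Q)
        := (Q :* y :+ m :- Q :* x) :* (Q :* x :+ m :- Q :* y)
           :+ (s :+ (con (+ 2) :* M :- m)) :* (s :+ con (+ 2) :* M :+ m)) refl M D Q m x y)
      where
      slack : 0# ≤ fromℕ 14 * M + 16ₙ * D * M
      slack = fromℕ-nonneg 14 ⊗ <⇒≤ 0<M ⊕ fromℕ-nonneg 16 ⊗ <⇒≤ 0<D ⊗ <⇒≤ 0<M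

  module _ {X H M w Q : Carrier} (0<X : 0# < X) (0<H : 0# < H) (0<M : 0# < M) (0≤w : 0# ≤ w)
           (1≤Q : fromℕ 1 ≤ Q) (X≤H³ : X ≤ H * H * H) (w⁴≈HX : w * w * w * w ≈ H * X) (Qw≤M : Q * w ≤ M)
               where

    private
      0<Q : 0# < Q
      0<Q = <-≤-trans (fromℕ-pos 0) 1≤Q

      HX≤w⁴ : H * X ≤ w * w * w * w
      HX≤w⁴ = inj₂ (sym w⁴≈HX)

      0≤w⁴ : 0# ≤ w * w * w * w
      0≤w⁴ = 0≤w ⊗ 0≤w ⊗ 0≤w ⊗ 0≤w

      0≤HX : 0# ≤ H * X
      0≤HX = <⇒≤ 0<H ⊗ <⇒≤ 0<X

      Q²w²≤M² : Q * w * (Q * w) ≤ M * M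
      Q²w²≤M² = *-mono-≤ (<⇒≤ 0<Q ⊗ 0≤w) (<⇒≤ 0<Q ⊗ 0≤w) Qw≤M Qw≤M

      -- Compare fourth powers: `(w³)⁴ = (H X)³ ≥ X⁴` since `H³ ≥ X`.
      X≤w³ : X ≤ w * w * w
      X≤w³ = ≤-sq⁻ (0≤w ⊗ 0≤w ⊗ 0≤w) (≤-sq⁻ (sq-nonneg _)
        (by≤ (diff≤ HX≤w⁴ ⊗ (0≤w⁴ ⊗ 0≤w⁴ ⊕ 0≤w⁴ ⊗ 0≤HX ⊕ 0≤HX ⊗ 0≤HX) ⊕ <⇒≤ 0<X ⊗ sq-nonneg X ⊗ diff≤ X≤H³)
          (solve 3 (λ X H w → let w³ = w :* w :* w ; w⁴ = w³ :* w in
            w³ :* w³ :* (w³ :* w³) :- X :* X :* (X :* X)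
            := (w⁴ :- H :* X) :* (w⁴ :* w⁴ :+ w⁴ :* (H :* X) :+ H :* X :* (H :* X)) :+ X :* (X :* X) :*
                (H :* H :* H :- X)) refl X H w)))

      -- Compare squares: `(H w²)² = H³ X ≥ X²`.
      X≤Hw² : X ≤ H * (w * w)
      X≤Hw² = ≤-sq⁻ (<⇒≤ 0<H ⊗ sq-nonneg w)
        (by≤ (sq-nonneg H ⊗ diff≤ HX≤w⁴ ⊕ <⇒≤ 0<X ⊗ diff≤ X≤H³)
          (solve 3 (λ X H w → H :* (w :* w) :* (H :* (w :* w)) :- X :* X
            := H :* H :* (w :* w :* w :* w :- H :* X) :+ X :* (H :* H :* H :- X)) refl X H w))

    module _ {q : Carrier} (1≤q : fromℕ 1 ≤ q) (q≤Q : q ≤ Q) where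
      private
        0<q : 0# < q
        0<q = <-≤-trans (fromℕ-pos 0) 1≤q

      -- `X Q² q ≤ w³ Q³ ≤ M³`. With the denominator cleared this says `U ≥ 1`, so additive
      -- constants in the count can be charged to `U`.
      1≤U : X * (Q * Q) * q ≤ M * M * M
      1≤U = by≤ (diff≤ Qw≤M ⊗ (sq-nonneg M ⊕ <⇒≤ 0<M ⊗ (<⇒≤ 0<Q ⊗ 0≤w) ⊕ sq-nonneg (Q * w))
                 ⊕ <⇒≤ 0<Q ⊗ sq-nonneg Q ⊗ diff≤ X≤w³ ⊕ <⇒≤ 0<X ⊗ sq-nonneg Q ⊗ diff≤ q≤Q)
        (solve 5 (λ X M w Q q → M :* M :* M :- X :* (Q :* Q) :* q
          := (M :- Q :* w) :* (M :* M :+ M :* (Q :* w) :+ Q :* w :* (Q :* w))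
             :+ Q :* (Q :* Q) :* (w :* w :* w :- X) :+ X :* (Q :* Q) :* (Q :- q)) refl X M w Q q)

      private
        q²Q²HX≤M⁴ : q * q * (Q * Q) * (H * X) ≤ M * M * (M * M)
        q²Q²HX≤M⁴ = by≤
          (sq-nonneg q ⊗ sq-nonneg Q ⊗ diff≤ HX≤w⁴ ⊕ diff≤ Q²w²≤M² ⊗ (sq-nonneg M ⊕ sq-nonneg (Q * w))
            ⊕ 0≤w⁴ ⊗ sq-nonneg Q ⊗ diff≤ q≤Q ⊗ (<⇒≤ 0<Q ⊕ <⇒≤ 0<q))
          (solve 6 (λ X H M w Q q → M :* M :* (M :* M) :- q :* q :* (Q :* Q) :* (H :* X)
            := q :* q :* (Q :* Q) :* (w :* w :* w :* w :- H :* X)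
               :+ (M :* M :- Q :* w :* (Q :* w)) :* (M :* M :+ Q :* w :* (Q :* w))
               :+ w :* w :* w :* w :* (Q :* Q) :* (Q :- q) :* (Q :+ q)) refl X H M w Q q)

      module _ {a σ κ : Carrier} (0<a : 0# < a) (0≤σ : 0# ≤ σ) (0≤κ : 0# ≤ κ)
               (σ²≈4aqX : σ * σ ≈ 4ₙ * (a * q) * X)
               (Xq≤16aM² : X * q ≤ 16ₙ * (a * (M * M))) (aM²≤κXq : a * (M * M) ≤ κ * (X * q)) where
        private
          0<p : 0# < a * q
          0<p = 0<a ⊠ 0<q

          -- The lower end of the range of `a` gives `(X q)² ≤ 16 a M² X q = 4 M² σ²`. It lets `σ`,
          -- which the geometry of the lines produces, be traded for the `X q` in `U`.
          Xq≤2σM : X * q ≤ 2ₙ * σ * M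
          Xq≤2σM = ≤-sq⁻ (fromℕ-nonneg 2 ⊗ 0≤σ ⊗ <⇒≤ 0<M)
            (by≤ (fromℕ-nonneg 4 ⊗ sq-nonneg M ⊗ diff≤ (inj₂ (sym σ²≈4aqX)) ⊕ <⇒≤ 0<X ⊗ <⇒≤ 0<q ⊗ diff≤
                Xq≤16aM²)
              (solve 5 (λ X M q a σ → con (+ 2) :* σ :* M :* (con (+ 2) :* σ :* M) :- X :* q :* (X :* q)
                := con (+ 4) :* (M :* M) :* (σ :* σ :- con (+ 4) :* (a :* q) :* X)
                   :+ X :* q :* (con (+ 16) :* (a :* (M :* M)) :- X :* q)) refl X M q a σ))
           

          aqHQ²≤κM² : a * q * H * (Q * Q) ≤ κ * (M * M)
          aqHQ²≤κM² = ≤-cancelˡ (0<M ⊠ 0<M)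
            (by≤ (<⇒≤ 0<q ⊗ <⇒≤ 0<H ⊗ sq-nonneg Q ⊗ diff≤ aM²≤κXq ⊕ 0≤κ ⊗ diff≤ q²Q²HX≤M⁴)
              (solve 7 (λ X H M Q q a κ → M :* M :* (κ :* (M :* M)) :- M :* M :* (a :* q :* H :* (Q :* Q))
                := q :* H :* (Q :* Q) :* (κ :* (X :* q) :- a :* (M :* M))
                   :+ κ :* (M :* M :* (M :* M) :- q :* q :* (Q :* Q) :* (H :* X))) refl X H M Q q a κ))

        module _ {t k : Carrier} (0≤k : 0# ≤ k) (σ+k≤t : σ + k ≤ t) where
          private
            2σk≤ : 0# ≤ (t - (σ + k)) * (t + σ) + (k * (t - (σ + k)) + k * k)
            2σk≤ = diff≤ σ+k≤t ⊗ (≤-trans (0≤σ ⊕ 0≤k) σ+k≤t ⊕ 0≤σ) ⊕ (0≤k ⊗ diff≤ σ+k≤t ⊕ sq-nonneg k)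

          -- From `t ≥ σ + k` comes `2 σ k ≤ t² - σ² ≤ d² + 4 a q H`. After multiplication by
          -- `Q² M`, closeness bounds `d² Q²` by `K₂ M²`, the range of `a` bounds `4 a q H Q²` by
          -- `4 κ M²`, and the left side dominates `k X Q² q`.
          line-bound : ∀ {d K₂} → t * t ≤ d * d + (σ * σ + 4ₙ * (a * q) * H) → d * Q * (d * Q) ≤ K₂ *
              (M * M) →
                       k * (X * (Q * Q) * q) ≤ (4ₙ * κ + K₂) * (M * M * M)
          line-bound {d} {K₂} t²≤ dQ≤ = by≤
            (diff≤ Xq≤2σM ⊗ 0≤k ⊗ sq-nonneg Q
              ⊕ <⇒≤ 0<M ⊗ (diff≤ dQ≤ ⊕ fromℕ-nonneg 4 ⊗ diff≤ aqHQ²≤κM² ⊕ sq-nonneg Q ⊗ (diff≤ t²≤ ⊕ 2σk≤)))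
            (solve 12 (λ X H M Q q a σ κ t k d K₂ →
              (con (+ 4) :* κ :+ K₂) :* (M :* M :* M) :- k :* (X :* (Q :* Q) :* q)
              := (con (+ 2) :* σ :* M :- X :* q) :* k :* (Q :* Q)
                 :+ M :* (K₂ :* (M :* M) :- d :* Q :* (d :* Q) :+ con (+ 4) :*
                     (κ :* (M :* M) :- a :* q :* H :* (Q :* Q))
                   :+ Q :* Q :* ((d :* d :+ (σ :* σ :+ con (+ 4) :* (a :* q) :* H)) :- t :* t
                     :+ ((t :- (σ :+ k)) :* (t :+ σ) :+ (k :* (t :- (σ :+ k)) :+ k :* k))))) refl X H M
                         Q q a σ κ t k d K₂)

          module _ {y e L : Carrier} (0≤y : 0# ≤ y) (0≤e : 0# ≤ e) (0≤L : 0# ≤ L)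
              (HQ≤2LM : H * Q ≤ 2ₙ * L * M)
                   (t²≤ : t * t ≤ y * y + (σ * σ + 4ₙ * (a * q) * H))
                   (≤t² : (y + 2ₙ * (a * q) * L * e) * (y + 2ₙ * (a * q) * L * e) + σ * σ ≤ t * t) where
            private
              B = 4ₙ * (a * q) * H
              ℓ = 2ₙ * (a * q) * L * e

              0≤B : 0# ≤ B
              0≤B = fromℕ-nonneg 4 ⊗ <⇒≤ 0<p ⊗ <⇒≤ 0<H

              0≤ℓ : 0# ≤ ℓ
              0≤ℓ = fromℕ-nonneg 2 ⊗ <⇒≤ 0<p ⊗ 0≤L ⊗ 0≤e

              -- `ℓ` is the growth of `|d|` over `e L` steps, starting from `y`, and `B` is the
              -- width of the strip as measured by `t² - d²`. Both ends of the run share `t`, so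
              -- `d²` can grow by at most `B`.
              ℓ²+2yℓ≤B : ℓ * ℓ + 2ₙ * (y * ℓ) ≤ B
              ℓ²+2yℓ≤B = by≤ (diff≤ t²≤ ⊕ diff≤ ≤t²)
                (solve 5 (λ t y ℓ s B → B :- (ℓ :* ℓ :+ con (+ 2) :* (y :* ℓ))
                  := (y :* y :+ (s :+ B)) :- t :* t :+ (t :* t :- ((y :+ ℓ) :* (y :+ ℓ) :+ s))) refl t y
                      ℓ (σ * σ) B)

              ℓ²≤B : ℓ * ℓ ≤ B
              ℓ²≤B = by≤ (diff≤ ℓ²+2yℓ≤B ⊕ fromℕ-nonneg 2 ⊗ (0≤y ⊗ 0≤ℓ))
                (solve 3 (λ y ℓ B → B :- ℓ :* ℓ := B :- (ℓ :* ℓ :+ con (+ 2) :* (y :* ℓ)) :+ con (+ 2)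
                    :* (y :* ℓ)) refl y ℓ B)

              -- On the `k`-th line `y² + B ≥ t² - σ² ≥ 2 σ k`. Multiplied by `ℓ²`, the left side is
              -- at most `2 B²`, because `y ℓ` and `ℓ²` are both at most `B`.
              ℓ²σk≤B² : ℓ * ℓ * (2ₙ * (σ * k)) ≤ 2ₙ * (B * B)
              ℓ²σk≤B² = by≤
                (sq-nonneg ℓ ⊗ (diff≤ t²≤ ⊕ 2σk≤) ⊕ 0≤B ⊗ diff≤ ℓ²≤B
                  ⊕ (diff≤ ℓ²+2yℓ≤B ⊕ sq-nonneg ℓ ⊕ 0≤y ⊗ 0≤ℓ) ⊗ (0≤B ⊕ 0≤y ⊗ 0≤ℓ))
                (solve 6 (λ t y ℓ σ B k → con (+ 2) :* (B :* B) :- ℓ :* ℓ :* (con (+ 2) :* (σ :* k))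
                  := ℓ :* ℓ :* ((y :* y :+ (σ :* σ :+ B)) :- t :* t
                       :+ ((t :- (σ :+ k)) :* (t :+ σ) :+ (k :* (t :- (σ :+ k)) :+ k :* k)))
                     :+ B :* (B :- ℓ :* ℓ)
                     :+ (B :- (ℓ :* ℓ :+ con (+ 2) :* (y :* ℓ)) :+ ℓ :* ℓ :+ y :* ℓ) :* (B :+ y :* ℓ))
                         refl t y ℓ σ B k)

              e²L²σk≤4H² : e * e * (L * L) * (σ * k) ≤ 4ₙ * (H * H)
              e²L²σk≤4H² = ≤-cancelˡ (fromℕ-pos 7 ⊠ (0<p ⊠ 0<p))
                (by≤ (diff≤ ℓ²σk≤B²)
                  (solve 6 (λ p L e H σ k → let B = con (+ 4) :* p :* H ; ℓ = con (+ 2) :* p :* L :* e in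
                    con (+ 8) :* (p :* p) :* (con (+ 4) :* (H :* H)) :- con (+ 8) :* (p :* p) :*
                        (e :* e :* (L :* L) :* (σ :* k))
                    := con (+ 2) :* (B :* B) :- ℓ :* ℓ :* (con (+ 2) :* (σ :* k))) refl (a * q) L e H σ k))

              aqL²e²≤H : a * q * (L * L) * (e * e) ≤ H
              aqL²e²≤H = ≤-cancelˡ (fromℕ-pos 3 ⊠ 0<p)
                (by≤ (diff≤ ℓ²≤B)
                  (solve 4 (λ p L e H → let B = con (+ 4) :* p :* H ; ℓ = con (+ 2) :* p :* L :* e in
                    con (+ 4) :* p :* H :- con (+ 4) :* p :* (p :* (L :* L) :* (e :* e))
                    := B :- ℓ :* ℓ) refl (a * q) L e H))

              0≤HQ : 0# ≤ H * Q
              0≤HQ = <⇒≤ 0<H ⊗ <⇒≤ 0<Q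

              aqHQ²e²≤4M² : a * q * H * (Q * Q) * (e * e) ≤ 4ₙ * (M * M)
              aqHQ²e²≤4M² = ≤-cancelˡ 0<H
                (by≤ (fromℕ-nonneg 4 ⊗ sq-nonneg M ⊗ diff≤ aqL²e²≤H
                      ⊕ <⇒≤ 0<p ⊗ sq-nonneg e ⊗ diff≤ HQ≤2LM ⊗ (fromℕ-nonneg 2 ⊗ 0≤L ⊗ <⇒≤ 0<M ⊕ 0≤HQ))
                  (solve 6 (λ p L e H M Q →
                    H :* (con (+ 4) :* (M :* M)) :- H :* (p :* H :* (Q :* Q) :* (e :* e))
                    := con (+ 4) :* (M :* M) :* (H :- p :* (L :* L) :* (e :* e))
                       :+ p :* (e :* e) :* (con (+ 2) :* L :* M :- H :* Q) :*
                           (con (+ 2) :* L :* M :+ H :* Q)) refl (a * q) L e H M Q))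

            -- `X q` is traded for `2 σ M` and `(H Q)²` for `(2 L M)²`, after which
            -- `e² L² σ k ≤ 4 H²` applies; 32 is `2 · 4 · 4`.
            run-bound : e * e * k * (X * (Q * Q) * q) ≤ 32ₙ * (M * M * M)
            run-bound = ≤-cancelˡ (0<H ⊠ 0<H)
              (by≤ (sq-nonneg H ⊗ sq-nonneg Q ⊗ sq-nonneg e ⊗ 0≤k ⊗ diff≤ Xq≤2σM
                    ⊕ fromℕ-nonneg 2 ⊗ <⇒≤ 0<M ⊗ (fromℕ-nonneg 4 ⊗ sq-nonneg M ⊗ diff≤ e²L²σk≤4H²
                      ⊕ sq-nonneg e ⊗ 0≤k ⊗ 0≤σ ⊗ diff≤ HQ≤2LM ⊗ (fromℕ-nonneg 2 ⊗ 0≤L ⊗ <⇒≤ 0<M ⊕ 0≤HQ)))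
                (solve 9 (λ X H M Q q σ k e L →
                  H :* H :* (con (+ 32) :* (M :* M :* M)) :- H :* H :* (e :* e :* k :* (X :* (Q :* Q) :* q))
                  := H :* H :* (Q :* Q) :* (e :* e) :* k :* (con (+ 2) :* σ :* M :- X :* q)
                     :+ con (+ 2) :* M :* (con (+ 4) :* (M :* M) :*
                         (con (+ 4) :* (H :* H) :- e :* e :* (L :* L) :* (σ :* k))
                        :+ e :* e :* k :* σ :* (con (+ 2) :* L :* M :- H :* Q) :*
                            (con (+ 2) :* L :* M :+ H :* Q)))
                  refl X H M Q q σ k e L))

            -- This serves the line `k = 0`, which may be almost tangent and where the previous
            -- bound is void. After squaring, replace in turn `X q` by `16 a M²`, `a q H Q² e²` by
            -- `4 M²`, `X` by `H w²` and `Q² w²` by `M²`.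
            first-run-bound : e * (X * (Q * Q) * q) ≤ 8ₙ * (M * M * M)
            first-run-bound = ≤-sq⁻ (fromℕ-nonneg 8 ⊗ (sq-nonneg M ⊗ <⇒≤ 0<M)) (≤-cancelˡ 0<H
              (by≤ (<⇒≤ 0<X ⊗ sq-nonneg Q ⊗ sq-nonneg e ⊗ sq-nonneg Q ⊗ <⇒≤ 0<H ⊗ <⇒≤ 0<q ⊗ diff≤ Xq≤16aM²
                    ⊕ fromℕ-nonneg 16 ⊗ sq-nonneg M ⊗ <⇒≤ 0<X ⊗ sq-nonneg Q ⊗ diff≤ aqHQ²e²≤4M²
                    ⊕ fromℕ-nonneg 64 ⊗ sq-nonneg M ⊗ sq-nonneg M ⊗ sq-nonneg Q ⊗ diff≤ X≤Hw²
                    ⊕ fromℕ-nonneg 64 ⊗ sq-nonneg M ⊗ sq-nonneg M ⊗ <⇒≤ 0<H ⊗ diff≤ Q²w²≤M²)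
                (solve 8 (λ X H M w Q q a e →
                    let E = e :* (X :* (Q :* Q) :* q) ; F = con (+ 8) :* (M :* M :* M) in
                  H :* (F :* F) :- H :* (E :* E)
                  := X :* (Q :* Q) :* (e :* e) :* (Q :* Q) :* H :* q :*
                      (con (+ 16) :* (a :* (M :* M)) :- X :* q)
                     :+ con (+ 16) :* (M :* M) :* X :* (Q :* Q) :*
                         (con (+ 4) :* (M :* M) :- a :* q :* H :* (Q :* Q) :* (e :* e))
                     :+ con (+ 64) :* (M :* M) :* (M :* M) :* (Q :* Q) :* (H :* (w :* w) :- X)
                     :+ con (+ 64) :* (M :* M) :* (M :* M) :* H :* (M :* M :- Q :* w :* (Q :* w))) refl
                         X H M w Q q a e)))

-- Arcs around fractions, and convexity of the choice of fraction

module FareyArcs {c ℓ₁ ℓ₂} (ℝ : RealField c ℓ₁ ℓ₂) where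
  open RealField ℝ
  open OrderedField ℝ
  open Solver using (solve; _:+_; _:*_; _:-_; _:=_; con)

  -- Nearness over the field, where `m - j * q` needs no truncated subtraction and the ring solver
  -- applies.
  Nearᶠ : (Q m n a q : Carrier) → Set _
  Nearᶠ Q m n a q = Q * (a * m) < Q * (q * n) + m × Q * (q * n) < Q * (a * m) + m

  private
    side : ∀ Q x y → fromℕ (Q ℕ.* (x ℕ.* y)) ≈ fromℕ Q * (fromℕ x * fromℕ y)
    side Q x y = trans (fromℕ-* Q (x ℕ.* y)) (*-congˡ (fromℕ-* x y))

    side+ : ∀ Q x y m → fromℕ (Q ℕ.* (x ℕ.* y) ℕ.+ m) ≈ fromℕ Q * (fromℕ x * fromℕ y) + fromℕ m
    side+ Q x y m = trans (fromℕ-+ (Q ℕ.* (x ℕ.* y)) m) (+-congʳ (side Q x y))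

  toNearᶠ : ∀ {Q m n a q} → Near Q m n a q → Nearᶠ (fromℕ Q) (fromℕ m) (fromℕ n) (fromℕ a) (fromℕ q)
  toNearᶠ {Q} {m} {n} {a} {q} (h & k) =
    <-resp-≈ (side Q a m) (side+ Q q n m) (fromℕ-mono-< h) ,
    <-resp-≈ (side Q q n) (side+ Q a m m) (fromℕ-mono-< k)

  fromNearᶠ : ∀ {Q m n a q} → Nearᶠ (fromℕ Q) (fromℕ m) (fromℕ n) (fromℕ a) (fromℕ q) → Near Q m n a q
  fromNearᶠ {Q} {m} {n} {a} {q} (h , k) =
    fromℕ-cancel-< {Q ℕ.* (a ℕ.* m)} {Q ℕ.* (q ℕ.* n) ℕ.+ m}
        (<-resp-≈ (sym (side Q a m)) (sym (side+ Q q n m)) h) &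
    fromℕ-cancel-< {Q ℕ.* (q ℕ.* n)} {Q ℕ.* (a ℕ.* m) ℕ.+ m}
        (<-resp-≈ (sym (side Q q n)) (sym (side+ Q a m m)) k)

  Nearᶠ-resp : ∀ {Q m m′ n n′ a q} → m ≈ m′ → n ≈ n′ → Nearᶠ Q m n a q → Nearᶠ Q m′ n′ a q
  Nearᶠ-resp p r (h , k) =
    <-resp-≈ (*-congˡ (*-congˡ p)) (+-cong (*-congˡ (*-congˡ r)) p) h ,
    <-resp-≈ (*-congˡ (*-congˡ r)) (+-cong (*-congˡ (*-congˡ p)) p) k

  module _ {Q m n a q b r : Carrier} (1≤Q : fromℕ 1 ≤ Q) (0<m : 0# < m) (0≤a : 0# ≤ a) (0<q : 0# < q)
           (0≤b : 0# ≤ b) (0<r : 0# < r) where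
    private
      0≤Q : 0# ≤ Q
      0≤Q = ≤-trans (fromℕ-nonneg 1) 1≤Q

    -- The fractions are equal, so the arcs share their centre, and the one with the smaller
    -- denominator is the wider.
    proportional-near : q * b ≈ r * a → r ≤ q → Nearᶠ Q m n a q → Nearᶠ Q m n b r
    proportional-near qb≈ra r≤q (h , k) =
      <-cancelˡ (<⇒≤ 0<q) (by< (0<r ⊠ diff< h ⊞ diff≤ r≤q ⊗ <⇒≤ 0<m ⊞ 0≤Q ⊗ <⇒≤ 0<m ⊗ diff≤ (inj₂ qb≈ra))
        (solve 7 (λ Q m n a q b r → q :* (Q :* (r :* n) :+ m) :- q :* (Q :* (b :* m))
          := r :* (Q :* (q :* n) :+ m :- Q :* (a :* m)) :+ (q :- r) :* m :+ Q :* m :*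
              (r :* a :- q :* b)) refl Q m n a q b r)) ,
      <-cancelˡ (<⇒≤ 0<q) (by< (0<r ⊠ diff< k ⊞ diff≤ r≤q ⊗ <⇒≤ 0<m ⊞ 0≤Q ⊗ <⇒≤ 0<m ⊗ diff≤
          (inj₂ (sym qb≈ra)))
        (solve 7 (λ Q m n a q b r → q :* (Q :* (b :* m) :+ m) :- q :* (Q :* (r :* n))
          := r :* (Q :* (a :* m) :+ m :- Q :* (q :* n)) :+ (q :- r) :* m :+ Q :* m :*
              (q :* b :- r :* a)) refl Q m n a q b r))

    module _ {j : Carrier} (0≤j : 0# ≤ j) (r≤Q : r ≤ Q) where

      -- If b/r < a/q, then b/r lies left of the arc of a/q, so moving
      -- towards smaller n/m within that arc only brings b/r closer.
      near-forward : q * b + fromℕ 1 ≤ r * a → Nearᶠ Q m n b r →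
                     Nearᶠ Q (m + j * q) (n - j * a) a q → Nearᶠ Q (m + j * q) (n - j * a) b r
      near-forward det (_ , k) (h , _) =
        <-cancelˡ (<⇒≤ 0<q) (by<
          (0<q ⊠ 0<m₃ ⊞ 0≤Q ⊗ <⇒≤ 0<m₃ ⊗ diff≤ det ⊞ <⇒≤ (0<r ⊠ diff< h) ⊞ diff≤ r≤Q ⊗ <⇒≤ 0<m₃)
          (solve 8 (λ Q m n a q b r j → let m₃ = m :+ j :* q ; n₃ = n :- j :* a in
            q :* (Q :* (r :* n₃) :+ m₃) :- q :* (Q :* (b :* m₃))
            := q :* m₃ :+ Q :* m₃ :* (r :* a :- (q :* b :+ con (+ 1)))
               :+ r :* (Q :* (q :* n₃) :+ m₃ :- Q :* (a :* m₃)) :+ (Q :- r) :* m₃) refl Q m n a q b r j)) ,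
        by< (diff< k ⊞ 0≤j ⊗ <⇒≤ 0<q ⊞ 0≤Q ⊗ 0≤b ⊗ 0≤j ⊗ <⇒≤ 0<q ⊞ 0≤Q ⊗ <⇒≤ 0<r ⊗ 0≤j ⊗ 0≤a)
          (solve 8 (λ Q m n a q b r j → let m₃ = m :+ j :* q ; n₃ = n :- j :* a in
            Q :* (b :* m₃) :+ m₃ :- Q :* (r :* n₃)
            := (Q :* (b :* m) :+ m :- Q :* (r :* n)) :+ j :* q :+ Q :* b :* j :* q :+ Q :* r :* j :* a)
                refl Q m n a q b r j)
        where
        0<m₃ : 0# < m + j * q
        0<m₃ = 0<m ⊞ 0≤j ⊗ <⇒≤ 0<q

      -- The mirror image: `b/r` now lies to the right of the arc, and `n/m` moves up towards it.
      -- Going back shrinks the tolerance `m` by `j q`, but `Q b m` shrinks by `Q b j q`, which is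
      -- at least as much when `b ≥ 1`.
      near-backward : fromℕ 1 ≤ b → 0# < m - j * q → r * a + fromℕ 1 ≤ q * b → Nearᶠ Q m n b r →
                      Nearᶠ Q (m - j * q) (n + j * a) a q → Nearᶠ Q (m - j * q) (n + j * a) b r
      near-backward 1≤b 0<m₁ det (h , _) (_ , k) =
        by< (diff< h ⊞ 0≤Q ⊗ <⇒≤ 0<r ⊗ 0≤j ⊗ 0≤a ⊞ 0≤j ⊗ <⇒≤ 0<q ⊗ (0≤Q ⊗ diff≤ 1≤b ⊕ diff≤ 1≤Q))
          (solve 8 (λ Q m n a q b r j → let m₁ = m :- j :* q ; n₁ = n :+ j :* a in
            Q :* (r :* n₁) :+ m₁ :- Q :* (b :* m₁)
            := (Q :* (r :* n) :+ m :- Q :* (b :* m)) :+ Q :* r :* j :* a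
               :+ j :* q :* (Q :* (b :- con (+ 1)) :+ (Q :- con (+ 1)))) refl Q m n a q b r j) ,
        <-cancelˡ (<⇒≤ 0<q) (by<
          (0<q ⊠ 0<m₁ ⊞ 0≤Q ⊗ <⇒≤ 0<m₁ ⊗ diff≤ det ⊞ <⇒≤ (0<r ⊠ diff< k) ⊞ diff≤ r≤Q ⊗ <⇒≤ 0<m₁)
          (solve 8 (λ Q m n a q b r j → let m₁ = m :- j :* q ; n₁ = n :+ j :* a in
            q :* (Q :* (b :* m₁) :+ m₁) :- q :* (Q :* (r :* n₁))
            := q :* m₁ :+ Q :* m₁ :* (q :* b :- (r :* a :+ con (+ 1)))
               :+ r :* (Q :* (a :* m₁) :+ m₁ :- Q :* (q :* n₁)) :+ (Q :- r) :* m₁) refl Q m n a q b r j))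

  -- Along the direction `(q , -a)` the slope `n/m` decreases, so the earlier point supplies the
  -- upper bound and the later point the lower bound.
  near-between : ∀ {Q m n a q i j} → fromℕ 1 ≤ Q → fromℕ 1 ≤ a → 0# ≤ q → 0# ≤ i → 0# ≤ j →
                 Nearᶠ Q (m - i * q) (n + i * a) a q → Nearᶠ Q (m + j * q) (n - j * a) a q → Nearᶠ Q m n a q
  near-between {Q} {m} {n} {a} {q} {i} {j} 1≤Q 1≤a 0≤q 0≤i 0≤j (_ , k) (h , _) =
    by< (diff< h ⊞ 0≤j ⊗ 0≤q ⊗ (0≤Q ⊗ diff≤ 1≤a ⊕ diff≤ 1≤Q ⊕ 0≤Q ⊗ 0≤a))
      (solve 6 (λ Q m n a q j → let m₃ = m :+ j :* q ; n₃ = n :- j :* a in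
        Q :* (q :* n) :+ m :- Q :* (a :* m)
        := (Q :* (q :* n₃) :+ m₃ :- Q :* (a :* m₃)) :+ j :* q :*
            (Q :* (a :- con (+ 1)) :+ (Q :- con (+ 1)) :+ Q :* a)) refl Q m n a q j) ,
    by< (diff< k ⊞ 0≤i ⊗ 0≤q ⊗ (fromℕ-nonneg 2 ⊗ (0≤Q ⊗ 0≤a) ⊕ fromℕ-nonneg 1))
      (solve 6 (λ Q m n a q i → let m₁ = m :- i :* q ; n₁ = n :+ i :* a in
        Q :* (a :* m) :+ m :- Q :* (q :* n)
        := (Q :* (a :* m₁) :+ m₁ :- Q :* (q :* n₁)) :+ i :* q :* (con (+ 2) :* (Q :* a) :+ con (+ 1)))
            refl Q m n a q i)
    where
    0≤Q = ≤-trans (fromℕ-nonneg 1) 1≤Q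
    0≤a = ≤-trans (fromℕ-nonneg 1) 1≤a

  private
    det : ∀ {a b q r} → q ℕ.* b ℕ.< r ℕ.* a → fromℕ q * fromℕ b + fromℕ 1 ≤ fromℕ r * fromℕ a
    det {a} {b} {q} {r} h = ≤-resp-≈
      (trans (fromℕ-+ 1 (q ℕ.* b)) (trans (+-congˡ (fromℕ-* q b)) (+-comm _ _)))
      (fromℕ-* r a) (fromℕ-mono-≤ h)

  -- A fraction preferred to a/q lies outside the arc |n/m - a/q| < 1/(q Q), so
  -- its own arc cuts a piece off that arc at one end only.
  best-convex : ∀ {Q m₁ n₁ m₂ n₂ m₃ n₃} (B₁ : Best Q m₁ n₁) (B₂ : Best Q m₂ n₂) (B₃ : Best Q m₃ n₃)
      {a q i j} →
    1 ℕ.≤ Q → 1 ℕ.≤ m₁ → 1 ℕ.≤ m₂ → 1 ℕ.≤ m₃ → 1 ℕ.≤ a →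
    Best.a B₁ ≡ a → Best.q B₁ ≡ q → Best.a B₃ ≡ a → Best.q B₃ ≡ q →
    0# ≤ i → 0# ≤ j →
    fromℕ m₁ ≈ fromℕ m₂ - i * fromℕ q → fromℕ n₁ ≈ fromℕ n₂ + i * fromℕ a →
    fromℕ m₃ ≈ fromℕ m₂ + j * fromℕ q → fromℕ n₃ ≈ fromℕ n₂ - j * fromℕ a →
    Best.a B₂ ≡ a × Best.q B₂ ≡ q
  best-convex {Q} {m₁} {n₁} {m₂} {n₂} {m₃} {n₃} B₁ B₂ B₃ {a} {q} {i} {j}
    1≤Q 1≤m₁ 1≤m₂ 1≤m₃ 1≤a ≡.refl ≡.refl a≡ q≡ 0≤i 0≤j m₁≈ n₁≈ m₃≈ n₃≈ = conclusion
    where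
    module B₁ = Best B₁
    module B₂ = Best B₂
    module B₃ = Best B₃
    b = B₂.a
    r = B₂.q

    1≤Qᶠ = fromℕ-mono-≤ 1≤Q
    0<q = fromℕ-mono-< B₁.1≤q
    0<r = fromℕ-mono-< B₂.1≤q

    near₁ : Nearᶠ (fromℕ Q) (fromℕ m₂ - i * fromℕ q) (fromℕ n₂ + i * fromℕ a) (fromℕ a) (fromℕ q)
    near₁ = Nearᶠ-resp m₁≈ n₁≈ (toNearᶠ B₁.near)

    near₃ : Nearᶠ (fromℕ Q) (fromℕ m₂ + j * fromℕ q) (fromℕ n₂ - j * fromℕ a) (fromℕ a) (fromℕ q)
    near₃ = Nearᶠ-resp m₃≈ n₃≈ (toNearᶠ (≡.subst₂ (Near Q m₃ n₃) a≡ q≡ B₃.near))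

    near₂ : Near Q m₂ n₂ a q
    near₂ = fromNearᶠ (near-between 1≤Qᶠ (fromℕ-mono-≤ 1≤a) (<⇒≤ 0<q) 0≤i 0≤j near₁ near₃)

    r≤q : r ℕ.≤ q
    r≤q = B₂.q-least B₁.1≤q near₂

    r≡q⇒b≤a : r ≡ q → b ℕ.≤ a
    r≡q⇒b≤a r≡q = B₂.a-least (≡.subst (Near Q m₂ n₂ a) (≡.sym r≡q) near₂)

    conclusion : b ≡ a × r ≡ q
    conclusion with ℕ.<-cmp (q ℕ.* b) (r ℕ.* a)
    -- Here `b/r < a/q`, so `b/r` is near the third point too. Minimality there forces `r = q` and
    -- then `a ≤ b`, a contradiction.
    ... | tri< qb<ra _ _ = ⊥-elim (ℕ.<⇒≱ qb<ra
        (≡.subst (λ r → r ℕ.* a ℕ.≤ q ℕ.* b) (≡.sym r≡q) (ℕ.*-monoʳ-≤ q a≤b)))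
      where
      near₃′ : Near Q m₃ n₃ b r
      near₃′ = fromNearᶠ (Nearᶠ-resp (sym m₃≈) (sym n₃≈)
          (near-forward 1≤Qᶠ (fromℕ-mono-< 1≤m₂) (fromℕ-nonneg a) 0<q
        (fromℕ-nonneg b) 0<r 0≤j (fromℕ-mono-≤ B₂.q≤Q) (det {a} {b} {q} {r} qb<ra) (toNearᶠ B₂.near) near₃))
      r≡q = ℕ.≤-antisym r≤q (≡.subst (ℕ._≤ r) q≡ (B₃.q-least B₂.1≤q near₃′))
      a≤b = ≡.subst (ℕ._≤ b) a≡ (B₃.a-least (≡.subst (Near Q m₃ n₃ b) (≡.trans r≡q (≡.sym q≡)) near₃′))
    -- Here `b/r > a/q`, so `b/r` is near the first point too, which forces `r = q`; now minimality
    -- at the middle point gives `b ≤ a`.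
    ... | tri> _ _ ra<qb = ⊥-elim (ℕ.<⇒≱ ra<qb
        (≡.subst (λ r → q ℕ.* b ℕ.≤ r ℕ.* a) (≡.sym r≡q) (ℕ.*-monoʳ-≤ q (r≡q⇒b≤a r≡q))))
      where
      1≤b : 1 ℕ.≤ b
      1≤b = ℕ.n≢0⇒n>0 λ b≡0 → ℕ.n≮0 (≡.subst (r ℕ.* a ℕ.<_)
          (≡.trans (≡.cong (q ℕ.*_) b≡0) (ℕ.*-zeroʳ q)) ra<qb)
      near₁′ : Near Q m₁ n₁ b r
      near₁′ = fromNearᶠ (Nearᶠ-resp (sym m₁≈) (sym n₁≈)
          (near-backward 1≤Qᶠ (fromℕ-mono-< 1≤m₂) (fromℕ-nonneg a) 0<q
        (fromℕ-nonneg b) 0<r 0≤i (fromℕ-mono-≤ B₂.q≤Q) (fromℕ-mono-≤ 1≤b)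
            (<-resp-≈ refl m₁≈ (fromℕ-mono-< 1≤m₁))
        (det {b} {a} {r} {q} ra<qb) (toNearᶠ B₂.near) near₁))
      r≡q = ℕ.≤-antisym r≤q (B₁.q-least B₂.1≤q near₁′)
    ... | tri≈ _ qb≡ra _ = ℕ.*-cancelˡ-≡ b a q {{ℕ.>-nonZero B₁.1≤q}}
        (≡.trans qb≡ra (≡.cong (ℕ._* a) r≡q)) , r≡q
      where
      near₁′ : Near Q m₁ n₁ b r
      near₁′ = fromNearᶠ (proportional-near 1≤Qᶠ (fromℕ-mono-< 1≤m₁) (fromℕ-nonneg a) 0<q
          (fromℕ-nonneg b) 0<r
        (trans (sym (fromℕ-* q b)) (trans (reflexive (≡.cong fromℕ qb≡ra)) (fromℕ-* r a)))
            (fromℕ-mono-≤ r≤q) (toNearᶠ B₁.near))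
      r≡q = ℕ.≤-antisym r≤q (B₁.q-least B₂.1≤q near₁′)

  -- Cancelling a common factor keeps the value and widens the arc, so a factor above 1 would
  -- contradict the minimality of `q`.
  best-coprime : ∀ {Q m n} → 1 ℕ.≤ Q → 1 ℕ.≤ m → (B : Best Q m n) → ℕ.gcd (Best.a B) (Best.q B) ≡ 1
  best-coprime {Q} {m} {n} 1≤Q 1≤m B with ℕ.gcd[m,n]∣m (Best.a B) (Best.q B) | ℕ.gcd[m,n]∣n (Best.a B)
      (Best.q B)
  ... | ℕ.divides b a≡ | ℕ.divides r q≡ = ℕ.≤-antisym g≤1 1≤g
    where
    open Best B
    g = ℕ.gcd a q
    1≤r : 1 ℕ.≤ r
    1≤r = ℕ.n≢0⇒n>0 λ r≡0 → ℕ.n≮0 (≡.subst (0 ℕ.<_) (≡.trans q≡ (≡.cong (ℕ._* g) r≡0)) 1≤q)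
    1≤g : 1 ℕ.≤ g
    1≤g = ℕ.n≢0⇒n>0 λ g≡0 → ℕ.n≮0 (≡.subst (0 ℕ.<_)
        (≡.trans q≡ (≡.trans (≡.cong (r ℕ.*_) g≡0) (ℕ.*-zeroʳ r))) 1≤q)
    qb≡ra : q ℕ.* b ≡ r ℕ.* a
    qb≡ra = ≡.trans (≡.cong (ℕ._* b) q≡) (≡.trans (ℕ.*-assoc r g b)
        (≡.cong (r ℕ.*_) (≡.trans (ℕ.*-comm g b) (≡.sym a≡))))
    r≤q : r ℕ.≤ q
    r≤q = ≡.subst (r ℕ.≤_) (≡.sym q≡) (ℕ.m≤m*n r g {{ℕ.>-nonZero 1≤g}})
    near′ : Near Q m n b r
    near′ = fromNearᶠ (proportional-near (fromℕ-mono-≤ 1≤Q) (fromℕ-mono-< 1≤m) (fromℕ-nonneg a)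
        (fromℕ-mono-< 1≤q) (fromℕ-nonneg b) (fromℕ-mono-< 1≤r)
      (trans (sym (fromℕ-* q b)) (trans (reflexive (≡.cong fromℕ qb≡ra)) (fromℕ-* r a)))
          (fromℕ-mono-≤ r≤q) (toNearᶠ near))
    g≤1 : g ℕ.≤ 1
    g≤1 = ℕ.*-cancelˡ-≤ r {{ℕ.>-nonZero 1≤r}}
        (ℕ.≤-trans (ℕ.≤-reflexive (≡.sym q≡))
            (ℕ.≤-trans (q-least 1≤r near′) (ℕ.≤-reflexive (≡.sym (ℕ.*-identityʳ r)))))

-- Filing each point of the region under an admissible fraction

module Assignments {c ℓ₁ ℓ₂} (ℝ : RealField c ℓ₁ ℓ₂) where
  open RealField ℝ
  open Hyperbola ℝ
  open OrderedField ℝ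
  open Estimates ℝ
  open FareyArcs ℝ
  open Solver using (solve; _:+_; _:*_; _:-_; :-_; _:=_; con)

  /-cancel : ∀ {x y} → 0# < y → x / y * y ≈ x
  /-cancel {x} {y} 0<y = trans (*-assoc x (y ⁻¹) y)
      (trans (*-congˡ (trans (*-comm (y ⁻¹) y) (⁻¹-inverseʳ y≉0))) (*-identityʳ x))
    where
    y≉0 : ¬ (y ≈ 0#)
    y≉0 p = <-irrefl (<-resp-≈ refl p 0<y)

  before-≤ : ∀ b {x y z} → before b x y → y ≤ z → before b x z
  before-≤ true  p q = ≤-trans p q
  before-≤ false (lift p) q = lift (<-≤-trans p q)

  ≤-before : ∀ b {x y z} → x ≤ y → before b y z → before b x z
  ≤-before true  p q = ≤-trans p q
  ≤-before false p (lift q) = lift (≤-<-trans p q)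

  before? : ∀ b x y → Dec (before b x y)
  before? true  x y = x ≤? y
  before? false x y = map′ lift Lift.lower (x <? y)

  region? : ∀ X H J p → Dec (region X H J p)
  region? X H J (m , n) =
    (before? lowerClosed lower (fromℤ m) ×-dec before? upperClosed (fromℤ m) upper)
      ×-dec (X <? fromℤ (n ℤ.* m)) ×-dec (fromℤ (n ℤ.* m) ≤? (X + H))
    where open Interval J

  1≤-ℤ : ∀ {i} → 0# < fromℤ i → 1ℤ ℤ.≤ i
  1≤-ℤ {i} h = ℤ.i<j⇒suc[i]≤j (fromℤ-cancel-< {+ 0} {i} h)

  module Setting {X H M D : Carrier} (0<X : 0# < X) (0<H : 0# < H) (0<M : 0# < M) (0<D : 0# < D)
      (H≤X : H ≤ X)
    (M²≤DX : M * M ≤ D * X) (Q : ℕ) .{{_ : ℕ.NonZero Q}} (J : Interval)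
        (J⊆ : within J ⊆ within ⦅ M , 2# * M ⦆ˡ) where

    record S (p : ℤ²) : Set (ℓ₁ ⊔ ℓ₂) where
      constructor point
      field
        in-region : region X H J p

    κ K : Carrier
    κ = 3ₙ + D
    K = 16ₙ * (D + fromℕ 1)

    1≤Q : fromℕ 1 ≤ fromℕ Q
    1≤Q = fromℕ-mono-≤ (ℕ.>-nonZero⁻¹ Q)

    module _ {m n : ℤ} (p∈S : S (m , n)) where

      M≤m : M ≤ fromℤ m
      M≤m = <⇒≤ (Lift.lower (proj₁ (J⊆ (proj₁ (S.in-region p∈S)))))

      m≤2M : fromℤ m ≤ 2ₙ * M
      m≤2M = ≤-resp-≈ refl (*-congʳ (+-congˡ (sym (+-identityʳ 1#)))) (proj₂ (J⊆ (proj₁ (S.in-region p∈S))))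

      0<m : 0# < fromℤ m
      0<m = <-≤-trans 0<M M≤m

      X≤nm : X ≤ fromℤ n * fromℤ m
      X≤nm = ≤-resp-≈ refl (fromℤ-* n m) (<⇒≤ (proj₁ (proj₂ (S.in-region p∈S))))

      nm≤X+H : fromℤ n * fromℤ m ≤ X + H
      nm≤X+H = ≤-resp-≈ (fromℤ-* n m) refl (proj₂ (proj₂ (S.in-region p∈S)))

      0<n : 0# < fromℤ n
      0<n = <-cancelˡ (<⇒≤ 0<m) (<-resp-≈ (sym (zeroʳ _)) (*-comm _ _) (<-≤-trans 0<X X≤nm))

    -- Admissibility for `c₁ = 1/16` and `c₂ = κ` with all denominators cleared, the form in which
    -- the estimates produce and consume it.
    record Admissible′ (a q : ℤ) : Set (ℓ₁ ⊔ ℓ₂) where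
      field
        1≤q     : 1ℤ ℤ.≤ q
        q≤Q     : q ℤ.≤ + Q
        Xq≤     : X * fromℤ q ≤ 16ₙ * (fromℤ a * (M * M))
        ≤κXq    : fromℤ a * (M * M) ≤ κ * (X * fromℤ q)
        coprime : ℤ.gcd a q ≡ 1ℤ

      1≤a : 1ℤ ℤ.≤ a
      1≤a = 1≤-ℤ (<-cancelˡ (<⇒≤ (fromℕ-pos 15 ⊠ (0<M ⊠ 0<M)))
        (<-resp-≈ (sym (zeroʳ _)) (solve 2 (λ a M → con (+ 16) :* (a :* (M :* M)) := con (+ 16) :*
            (M :* M) :* a) refl (fromℤ a) M)
          (<-≤-trans (0<X ⊠ <-≤-trans (fromℕ-pos 0) (fromℤ-mono-≤ 1≤q)) Xq≤)))

    private
      Z = X / M ^ 2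

      Z*M² : Z * (M * M) ≈ X
      Z*M² = trans (*-congˡ (*-congˡ (sym (*-identityʳ M)))) (/-cancel (0<M ⊠ (0<M ⊠ 0<1)))

      c₁ = 1# / 16ₙ

      lower-scaled : ∀ q → 16ₙ * (M * M) * (c₁ * Z * q) ≈ X * q
      lower-scaled q = trans
        (solve 5 (λ s M c Z q → s :* (M :* M) :* (c :* Z :* q) := c :* s :* (Z :* (M :* M) :* q)) refl
            16ₙ M c₁ Z q)
        (trans (*-cong (/-cancel (fromℕ-pos 15)) (*-congʳ Z*M²)) (*-identityˡ _))

      upper-scaled : ∀ q → M * M * (κ * Z * q) ≈ κ * (X * q)
      upper-scaled q = trans
        (solve 4 (λ M κ Z q → M :* M :* (κ :* Z :* q) := κ :* (Z :* (M :* M) :* q)) refl M κ Z q)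
        (*-congˡ (*-congʳ Z*M²))

    fromAdmissible : ∀ {a q} → Admissible c₁ κ X M (+ Q) (a , q) → Admissible′ a q
    fromAdmissible {a} {q} ((1≤q , q≤Q) , (l , u) , g) = record
      { 1≤q = 1≤q ; q≤Q = q≤Q ; coprime = g
      ; Xq≤ = ≤-resp-≈ (lower-scaled (fromℤ q))
          (solve 2 (λ a M → con (+ 16) :* (M :* M) :* a := con (+ 16) :* (a :* (M :* M))) refl (fromℤ a) M)
          (by≤ (fromℕ-nonneg 16 ⊗ sq-nonneg M ⊗ diff≤ l)
            (solve 3 (λ z x y → z :* y :- z :* x := z :* (y :- x)) refl (16ₙ * (M * M))
                (c₁ * Z * fromℤ q) (fromℤ a)))
      ; ≤κXq = ≤-resp-≈ (*-comm _ _) (upper-scaled (fromℤ q))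
          (by≤ (sq-nonneg M ⊗ diff≤ u) (solve 3 (λ z x y → z :* y :- z :* x := z :* (y :- x)) refl
              (M * M) (fromℤ a) (κ * Z * fromℤ q)))
      }

    toAdmissible : ∀ {a q} → Admissible′ a q → Admissible c₁ κ X M (+ Q) (a , q)
    toAdmissible {a} {q} adm = (1≤q , q≤Q) ,
      (≤-cancelˡ (fromℕ-pos 15 ⊠ (0<M ⊠ 0<M)) (≤-resp-≈ (sym (lower-scaled (fromℤ q)))
          (solve 2 (λ a M → con (+ 16) :* (a :* (M :* M)) := con (+ 16) :* (M :* M) :* a) refl (fromℤ a)
              M) Xq≤) ,
       ≤-cancelˡ (0<M ⊠ 0<M) (≤-resp-≈ (*-comm _ _) (sym (upper-scaled (fromℤ q))) ≤κXq)) ,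
      coprime
      where open Admissible′ adm

    admissible? : ∀ a q → Dec (Admissible′ a q)
    admissible? a q = map′ fromAdmissible toAdmissible
      (((1ℤ ℤ.≤? q) ×-dec (q ℤ.≤? + Q)) ×-dec ((_ ≤? _) ×-dec (_ ≤? _)) ×-dec (ℤ.gcd a q ℤ.≟ 1ℤ))

    -- Each point (m , n) is filed under one fraction a/q close to n/m.
    record Assignment : Set (c ⊔ ℓ₁ ⊔ ℓ₂) where
      field
        fraction   : ℤ² → ℤ × ℤ
        admissible : ∀ {p a q} → S p → fraction p ≡ (a , q) → Admissible′ a q
        close      : ∀ {m n a q} → S (m , n) → fraction (m , n) ≡ (a , q) →
                     let d = fromℤ a * fromℤ m - fromℤ q * fromℤ n in
                     d * fromℕ Q * (d * fromℕ Q) ≤ K * K * (M * M)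
        convex     : ∀ {p a q} i j → let v = (q , ℤ.- a) in
                     S p → S (p +[ i ] v) → S ((p +[ i ] v) +[ j ] v) →
                     fraction p ≡ (a , q) → fraction ((p +[ i ] v) +[ j ] v) ≡ (a , q) →
                     fraction (p +[ i ] v) ≡ (a , q)

    private
      KM² : K * M * (K * M) ≈ K * K * (M * M)
      KM² = solve 2 (λ K M → K :* M :* (K :* M) := K :* K :* (M :* M)) refl K M

    -- Here n/m may be closest to 0/1, which is not admissible; but Q and Q n/m are
    -- bounded in terms of D, so that 1/1 is close enough to every point.
    coarseAssignment : fromℕ Q * X ≤ 8ₙ * (M * M) → Assignment
    coarseAssignment coarse = record
      { fraction   = λ _ → 1ℤ , 1ℤ
      ; admissible = λ _ eq → ≡.subst (λ (a , q) → Admissible′ a q) eq admissible₁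
      ; close      = λ {m} {n} p∈S eq → ≡.subst
          (λ (a , q) → let d = fromℤ a * fromℤ m - fromℤ q * fromℤ n in d * fromℕ Q * (d * fromℕ Q) ≤ K
              * K * (M * M))
          eq (close₁ p∈S)
      ; convex     = λ _ _ _ _ _ eq _ → eq
      }
      where
      admissible₁ : Admissible′ 1ℤ 1ℤ
      admissible₁ = record
        { 1≤q = ℤ.≤-refl ; q≤Q = ℤ.+≤+ (ℕ.>-nonZero⁻¹ Q) ; coprime = ≡.refl
        ; Xq≤ = ≤-resp-≈ (solve 1 (λ X → X := X :* con (+ 1)) refl X)
            (solve 1 (λ M → con (+ 16) :* (M :* M) := con (+ 16) :* (con (+ 1) :* (M :* M))) refl M)
            (coarse-lower 0<X 0<H 0<M 0<D H≤X M²≤DX 1≤Q coarse)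
        ; ≤κXq = by≤ (diff≤ M²≤DX ⊕ fromℕ-nonneg 3 ⊗ <⇒≤ 0<X)
            (solve 3 (λ M D X → (con (+ 3) :+ D) :* (X :* con (+ 1)) :- con (+ 1) :* (M :* M)
              := (D :* X :- M :* M) :+ con (+ 3) :* X) refl M D X)
        }

      close₁ : ∀ {m n} → S (m , n) → let d = fromℕ 1 * fromℤ m - fromℕ 1 * fromℤ n in
               d * fromℕ Q * (d * fromℕ Q) ≤ K * K * (M * M)
      close₁ {m} {n} p∈S = ≤-resp-≈
        (solve 3 (λ m n Q → let d = con (+ 1) :* m :- con (+ 1) :* n in
          (m :- n) :* Q :* ((m :- n) :* Q) := d :* Q :* (d :* Q)) refl (fromℤ m) (fromℤ n) (fromℕ Q))
        KM²
        (coarse-d 0<X 0<H 0<M 0<D H≤X M²≤DX 1≤Q coarse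
          (M≤m p∈S) (m≤2M p∈S) (<⇒≤ (0<n p∈S)) (nm≤X+H p∈S))

    private
      nearest : ℕ → ℕ → ℤ × ℤ
      -- A default value: `m` is positive throughout the region.
      nearest zero    n = 1ℤ , 1ℤ
      nearest (suc m) n = + Best.a B , + Best.q B
        where B = best Q (suc m) n

      nearest-convex : ∀ {m₁ n₁ m₂ n₂ m₃ n₃ a q i j} → 1 ℕ.≤ m₁ → 1 ℕ.≤ m₂ → 1 ℕ.≤ m₃ → 1ℤ ℤ.≤ a →
        nearest m₁ n₁ ≡ (a , q) → nearest m₃ n₃ ≡ (a , q) → 0# ≤ i → 0# ≤ j →
        fromℕ m₁ ≈ fromℕ m₂ - i * fromℤ q → fromℕ n₁ ≈ fromℕ n₂ + i * fromℤ a →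
        fromℕ m₃ ≈ fromℕ m₂ + j * fromℤ q → fromℕ n₃ ≈ fromℕ n₂ - j * fromℤ a →
        nearest m₂ n₂ ≡ (a , q)
      nearest-convex {suc m₁} {n₁} {suc m₂} {n₂} {suc m₃} {n₃} 1≤m₁ 1≤m₂ 1≤m₃ (ℤ.+≤+ 1≤a) ≡.refl eq 0≤i
          0≤j h₁ h₂ h₃ h₄ =
        let p , r = best-convex (best Q (suc m₁) n₁) (best Q (suc m₂) n₂) (best Q (suc m₃) n₃) (ℕ.>-nonZero⁻¹ Q)
                      1≤m₁ 1≤m₂ 1≤m₃ 1≤a ≡.refl ≡.refl (ℤ.+-injective (≡.cong proj₁ eq))
                          (ℤ.+-injective (≡.cong proj₂ eq))
                      0≤i 0≤j h₁ h₂ h₃ h₄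
        in ≡.cong₂ (λ a q → + a , + q) p r

      abs : ∀ i → 0# < fromℤ i → fromℕ ℤ.∣ i ∣ ≈ fromℤ i
      abs i h = reflexive (≡.cong fromℤ (ℤ.0≤i⇒+∣i∣≡i (ℤ.<⇒≤ (fromℤ-cancel-< {+ 0} {i} h))))

      absₘ : ∀ {m n} → S (m , n) → fromℕ ℤ.∣ m ∣ ≈ fromℤ m
      absₘ {m} p∈S = abs m (0<m p∈S)

      absₙ : ∀ {m n} → S (m , n) → fromℕ ℤ.∣ n ∣ ≈ fromℤ n
      absₙ {n = n} p∈S = abs n (0<n p∈S)

      1≤∣m∣ : ∀ {m n} → S (m , n) → 1 ℕ.≤ ℤ.∣ m ∣
      1≤∣m∣ {m} p∈S = fromℕ-cancel-< (<-resp-≈ refl (sym (absₘ p∈S)) (0<m p∈S))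

      step : ∀ x i y → fromℤ (x ℤ.+ + i ℤ.* y) ≈ fromℤ x + fromℕ i * fromℤ y
      step x i y = trans (fromℤ-+ x (+ i ℤ.* y)) (+-congˡ (fromℤ-* (+ i) y))

      step-neg : ∀ x i y → fromℤ (x ℤ.+ + i ℤ.* ℤ.- y) ≈ fromℤ x - fromℕ i * fromℤ y
      step-neg x i y = trans (step x i (ℤ.- y)) (trans (+-congˡ (*-congˡ (fromℤ-neg y)))
        (solve 3 (λ x i y → x :+ i :* (:- y) := x :- i :* y) refl (fromℤ x) (fromℕ i) (fromℤ y)))

    fineAssignment : 8ₙ * (M * M) ≤ fromℕ Q * X → Assignment
    fineAssignment fine = record
      { fraction = fraction ; admissible = admissible ; close = close ; convex = convex }
      where
      fraction : ℤ² → ℤ × ℤ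
      fraction (m , n) = nearest ℤ.∣ m ∣ ℤ.∣ n ∣

      nearest-near : ∀ {m n a q} → 1 ℕ.≤ m → nearest m n ≡ (a , q) →
                     Nearᶠ (fromℕ Q) (fromℕ m) (fromℕ n) (fromℤ a) (fromℤ q) ×
                     + 0 ℤ.≤ a × 1ℤ ℤ.≤ q × q ℤ.≤ + Q × ℤ.gcd a q ≡ 1ℤ
      nearest-near {suc m} {n} 1≤m ≡.refl = toNearᶠ near , ℤ.+≤+ ℕ.z≤n , ℤ.+≤+ 1≤q , ℤ.+≤+ q≤Q ,
        ≡.cong +_ (best-coprime (ℕ.>-nonZero⁻¹ Q) 1≤m B)
        where
        B = best Q (suc m) n
        open Best B

      near-at : ∀ {m n a q} → S (m , n) → fraction (m , n) ≡ (a , q) →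
                Nearᶠ (fromℕ Q) (fromℤ m) (fromℤ n) (fromℤ a) (fromℤ q)
      near-at p∈S eq = Nearᶠ-resp (absₘ p∈S) (absₙ p∈S) (proj₁ (nearest-near (1≤∣m∣ p∈S) eq))

      admissible : ∀ {p a q} → S p → fraction p ≡ (a , q) → Admissible′ a q
      admissible {m , n} p∈S eq = record
        { 1≤q = 1≤q ; q≤Q = q≤Q ; coprime = g
        ; Xq≤ = fine-lower 0<X 0<H 0<M 0<D H≤X M²≤DX 1≤Q (M≤m p∈S) (m≤2M p∈S) (nm≤X+H p∈S)
            (fromℤ-nonneg 0≤a) (fromℤ-mono-≤ 1≤q) fine
                  (X≤nm p∈S) (<⇒≤ (proj₂ (near-at p∈S eq)))
        ; ≤κXq = fine-upper 0<X 0<H 0<M 0<D H≤X M²≤DX 1≤Q (M≤m p∈S) (m≤2M p∈S) (nm≤X+H p∈S)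
            (fromℤ-nonneg 0≤a) (fromℤ-mono-≤ 1≤q) fine
                  (<⇒≤ (proj₁ (near-at p∈S eq)))
        }
        where
        facts = nearest-near (1≤∣m∣ p∈S) eq
        0≤a = proj₁ (proj₂ facts)
        1≤q = proj₁ (proj₂ (proj₂ facts))
        q≤Q = proj₁ (proj₂ (proj₂ (proj₂ facts)))
        g = proj₂ (proj₂ (proj₂ (proj₂ facts)))

      close : ∀ {m n a q} → S (m , n) → fraction (m , n) ≡ (a , q) →
              let d = fromℤ a * fromℤ m - fromℤ q * fromℤ n in
              d * fromℕ Q * (d * fromℕ Q) ≤ K * K * (M * M)
      close p∈S eq = ≤-resp-≈ refl KM² (fine-d 0<X 0<H 0<M 0<D H≤X M²≤DX 1≤Q (m≤2M p∈S) (<⇒≤ (0<m p∈S))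
        (<⇒≤ (proj₁ (near-at p∈S eq))) (<⇒≤ (proj₂ (near-at p∈S eq))))

      convex : ∀ {p a q} i j → let v = (q , ℤ.- a) in
               S p → S (p +[ i ] v) → S ((p +[ i ] v) +[ j ] v) →
               fraction p ≡ (a , q) → fraction ((p +[ i ] v) +[ j ] v) ≡ (a , q) →
               fraction (p +[ i ] v) ≡ (a , q)
      convex {m , n} {a} {q} i j p₁ p₂ p₃ eq₁ eq₃ =
        nearest-convex (1≤∣m∣ p₁) (1≤∣m∣ p₂) (1≤∣m∣ p₃) (Admissible′.1≤a (admissible p₁ eq₁)) eq₁ eq₃
          (fromℕ-nonneg i) (fromℕ-nonneg j)
          (trans (absₘ p₁) (sym (trans (+-congʳ (trans (absₘ p₂) (step m i q)))
            (solve 2 (λ x y → x :+ y :- y := x) refl (fromℤ m) (fromℕ i * fromℤ q)))))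
          (trans (absₙ p₁) (sym (trans (+-congʳ (trans (absₙ p₂) (step-neg n i a)))
            (solve 2 (λ x y → x :- y :+ y := x) refl (fromℤ n) (fromℕ i * fromℤ a)))))
          (trans (absₘ p₃) (trans (step (m ℤ.+ + i ℤ.* q) j q) (+-congʳ (sym (absₘ p₂)))))
          (trans (absₙ p₃) (trans (step-neg (n ℤ.+ + i ℤ.* ℤ.- a) j a) (+-congʳ (sym (absₙ p₂)))))

-- Integer solutions of a linear equation

abstract
  bézout : ∀ a q → ℕ.gcd a q ≡ 1 → ∃₂ λ α β → α ℤ.* + a ℤ.+ β ℤ.* + q ≡ 1ℤ
  bézout a q g≡1 with ℕ.Bézout.identity (≡.subst (ℕ.GCD a q) g≡1 (ℕ.gcd-GCD a q))
  ... | ℕ.Bézout.+- x y eq = + x , ℤ.- + y , (begin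
      + x ℤ.* + a ℤ.+ ℤ.- + y ℤ.* + q
        ≡⟨ ≡.cong₂ (λ u w → u ℤ.+ w) (ℤ.pos-* x a) (ℤ.neg-distribˡ-* (+ y) (+ q)) ⟨
      + (x ℕ.* a) ℤ.- + y ℤ.* + q
        ≡⟨ ≡.cong₂ (λ u w → + u ℤ.- w) eq (ℤ.pos-* y q) ⟨
      1ℤ ℤ.+ + (y ℕ.* q) ℤ.- + (y ℕ.* q)
        ≡⟨ ring (+ (y ℕ.* q)) ⟩
      1ℤ ∎)
    where
    open ≡.≡-Reasoning
    ring : ∀ z → 1ℤ ℤ.+ z ℤ.- z ≡ 1ℤ
    ring = ℤSolver.solve-∀
  ... | ℕ.Bézout.-+ x y eq = ℤ.- + x , + y , (begin
      ℤ.- + x ℤ.* + a ℤ.+ + y ℤ.* + q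
        ≡⟨ ≡.cong₂ (λ u w → u ℤ.+ w) (ℤ.neg-distribˡ-* (+ x) (+ a)) (ℤ.pos-* y q) ⟨
      ℤ.- (+ x ℤ.* + a) ℤ.+ + (y ℕ.* q)
        ≡⟨ ≡.cong₂ (λ u w → ℤ.- u ℤ.+ + w) (ℤ.pos-* x a) eq ⟨
      ℤ.- + (x ℕ.* a) ℤ.+ (1ℤ ℤ.+ + (x ℕ.* a))
        ≡⟨ ring (+ (x ℕ.* a)) ⟩
      1ℤ ∎)
    where
    open ≡.≡-Reasoning
    ring : ∀ z → ℤ.- z ℤ.+ (1ℤ ℤ.+ z) ≡ 1ℤ
    ring = ℤSolver.solve-∀

nonneg-shift : ∀ i n → ℤ.∣ i ∣ ℕ.≤ n → ∃ λ u → i ℤ.+ + n ≡ + u × u ℕ.≤ n ℕ.+ n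
nonneg-shift (+ k) n k≤n = k ℕ.+ n , ≡.refl , ℕ.+-monoˡ-≤ n k≤n
nonneg-shift -[1+ k ] n k<n = n ℕ.∸ suc k , ℤ.⊖-≥ k<n , ℕ.≤-trans (ℕ.m∸n≤m n (suc k)) (ℕ.m≤m+n n n)

n≤1+pred[n] : ∀ n → n ℕ.≤ suc (ℕ.pred n)
n≤1+pred[n] zero    = ℕ.z≤n
n≤1+pred[n] (suc n) = ℕ.≤-refl

-- Tiling and counting the points filed under one fraction

module LineTilings {c ℓ₁ ℓ₂} (ℝ : RealField c ℓ₁ ℓ₂) where
  open RealField ℝ
  open Hyperbola ℝ
  open OrderedField ℝ
  open Estimates ℝ
  open Assignments ℝ
  open Solver using (solve; _:+_; _:*_; _:-_; :-_; _:^_; _:=_; con)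

  module _ {X H M w D : Carrier} (0<X : 0# < X) (0<H : 0# < H) (0<M : 0# < M) (0<D : 0# < D) (H≤X : H ≤ X)
    (M²≤DX : M * M ≤ D * X) (Q : ℕ) .{{_ : ℕ.NonZero Q}} (J : Interval)
        (J⊆ : within J ⊆ within ⦅ M , 2# * M ⦆ˡ)
    (0≤w : 0# ≤ w) (X≤H³ : X ≤ H * H * H) (w⁴≈HX : w * w * w * w ≈ H * X) (Qw≤M : fromℕ Q * w ≤ M)
    (L : ℕ) .{{_ : ℕ.NonZero L}} (HQ≤2LM : H * fromℕ Q ≤ 2ₙ * fromℕ L * M) where

    open Setting 0<X 0<H 0<M 0<D H≤X M²≤DX Q J J⊆

    module _ (A : Assignment) (a q : ℕ) .{{_ : ℕ.NonZero a}} .{{_ : ℕ.NonZero q}}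
        (adm : Admissible′ (+ a) (+ q)) where
      open Assignment A
      open Admissible′ adm

      private
        v : ℤ²
        v = + q , ℤ.- + a

        aᶠ = fromℕ a
        qᶠ = fromℕ q

        0<a : 0# < aᶠ
        0<a = fromℕ-mono-< (ℕ.>-nonZero⁻¹ a)

        0≤p : 0# ≤ aᶠ * qᶠ
        0≤p = fromℕ-nonneg a ⊗ fromℕ-nonneg q

        -- t² - δ² = 4 a q π on the line a m + q n = t
        δ π : ℤ² → Carrier
        δ (m , n) = aᶠ * fromℤ m - qᶠ * fromℤ n
        π (m , n) = fromℤ n * fromℤ m

        moveₘ : ∀ m i → fromℤ (m ℤ.+ + i ℤ.* + q) ≈ fromℤ m + fromℕ i * qᶠ
        moveₘ m i = trans (fromℤ-+ m (+ i ℤ.* + q)) (+-congˡ (fromℤ-* (+ i) (+ q)))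

        moveₙ : ∀ n i → fromℤ (n ℤ.+ + i ℤ.* ℤ.- + a) ≈ fromℤ n - fromℕ i * aᶠ
        moveₙ n i = trans (fromℤ-+ n (+ i ℤ.* ℤ.- + a)) (+-congˡ (trans (fromℤ-* (+ i) (ℤ.- + a))
          (trans (*-congˡ (fromℤ-neg (+ a))) (solve 2 (λ i a → i :* (:- a) := :- (i :* a)) refl
              (fromℕ i) aᶠ))))

        δ-step : ∀ p i → δ (p +[ i ] v) ≈ δ p + 2ₙ * (aᶠ * qᶠ) * fromℕ i
        δ-step (m , n) i = trans (+-cong (*-congˡ (moveₘ m i)) (-‿cong (*-congˡ (moveₙ n i))))
          (solve 5 (λ a q m n i → a :* (m :+ i :* q) :- q :* (n :- i :* a)
            := (a :* m :- q :* n) :+ con (+ 2) :* (a :* q) :* i) refl aᶠ qᶠ (fromℤ m) (fromℤ n) (fromℕ i))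

        π-step : ∀ p i → π (p +[ i ] v) ≈ π p - (fromℕ i * δ p + fromℕ i * fromℕ i * (aᶠ * qᶠ))
        π-step (m , n) i = trans (*-cong (moveₙ n i) (moveₘ m i))
          (solve 5 (λ a q m n i → (n :- i :* a) :* (m :+ i :* q)
            := n :* m :- (i :* (a :* m :- q :* n) :+ i :* i :* (a :* q))) refl aᶠ qᶠ (fromℤ m) (fromℤ n)
                (fromℕ i))

        -- Along a line `π` is a concave quadratic with its vertex at `δ = 0`. It is monotone on
        -- each side, so the strip meets each side in a single run; hence the split by the sign of
        -- `δ`.
        π-decreasing : ∀ p i → 0# ≤ δ p → π (p +[ i ] v) ≤ π p
        π-decreasing p i 0≤δ = ≤-resp-≈ (sym (π-step p i)) refl
          (by≤ (fromℕ-nonneg i ⊗ 0≤δ ⊕ sq-nonneg (fromℕ i) ⊗ 0≤p)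
            (solve 2 (λ x y → x :- (x :- y) := y) refl (π p)
                (fromℕ i * δ p + fromℕ i * fromℕ i * (aᶠ * qᶠ))))

        π-increasing : ∀ p i → δ (p +[ i ] v) ≤ 0# → π p ≤ π (p +[ i ] v)
        π-increasing p i δ≤0 = ≤-resp-≈ refl (sym (π-step p i))
          (by≤ (fromℕ-nonneg i ⊗ diff≤ (≤-resp-≈ (δ-step p i) refl δ≤0) ⊕ sq-nonneg (fromℕ i) ⊗ 0≤p)
            (solve 4 (λ x y z i → x :- (i :* y :+ i :* i :* z) :- x
              := i :* (con (+ 0) :- (y :+ con (+ 2) :* z :* i)) :+ i :* i :* z) refl (π p) (δ p)
                  (aᶠ * qᶠ) (fromℕ i)))

        side : Bool → Carrier → Set (ℓ₁ ⊔ ℓ₂)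
        side true  x = 0# ≤ x
        side false x = Lift ℓ₁ (x < 0#)

        side? : ∀ b x → Dec (side b x)
        side? true  x = 0# ≤? x
        side? false x = map′ lift Lift.lower (x <? 0#)

        σ : Carrier
        σ = (4ₙ * (aᶠ * qᶠ) * X) ^1/ 2

        0≤σ² : 0# ≤ 4ₙ * (aᶠ * qᶠ) * X
        0≤σ² = fromℕ-nonneg 4 ⊗ 0≤p ⊗ <⇒≤ 0<X

        0≤σ : 0# ≤ σ
        0≤σ = ^1/-nonNeg 2 0≤σ²

        σ² : σ * σ ≈ 4ₙ * (aᶠ * qᶠ) * X
        σ² = trans (*-congˡ (sym (*-identityʳ σ))) (^1/-root 2 0≤σ²)

        s₀ : ℕ
        s₀ = proj₁ (floor 0≤σ)

        -- On a line through a point of the region `t² = 4 a q n m + δ² > σ²`, so the integer `t` is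
        -- at least `⌊σ⌋ + 1`. Counting from there loses no line and still leaves `t k ≥ σ + k`.
        t : ℕ → ℕ
        t k = suc s₀ ℕ.+ k

        σ+k≤t : ∀ k → σ + fromℕ k ≤ fromℕ (t k)
        σ+k≤t k = ≤-resp-≈ refl (sym (fromℕ-+ (suc s₀) k))
          (by≤ (diff≤ (<⇒≤ (proj₂ (proj₂ (floor 0≤σ)))))
            (solve 3 (λ x y z → x :+ y :- (z :+ y) := x :- z) refl (fromℕ (suc s₀)) (fromℕ k) σ))

        record OnLine (b : Bool) (k : ℕ) (p : ℤ²) : Set (ℓ₁ ⊔ ℓ₂) where
          field
            member  : S p
            served  : fraction p ≡ (+ a , + q)
            line    : + a ℤ.* proj₁ p ℤ.+ + q ℤ.* proj₂ p ≡ + t k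
            on-side : side b (δ p)

          height : fromℕ (t k) ≈ aᶠ * fromℤ (proj₁ p) + qᶠ * fromℤ (proj₂ p)
          height = trans (reflexive (≡.cong fromℤ (≡.sym line)))
            (trans (fromℤ-+ (+ a ℤ.* proj₁ p) (+ q ℤ.* proj₂ p))
                (+-cong (fromℤ-* (+ a) (proj₁ p)) (fromℤ-* (+ q) (proj₂ p))))

        open OnLine

        onLine? : ∀ b k p → Dec (OnLine b k p)
        onLine? b k p@(m , n) = map′
          (λ (r , f , l , s) → record { member = point r ; served = f ; line = l ; on-side = s })
          (λ o → S.in-region (member o) , served o , line o , on-side o)
          (region? X H J p ×-dec ≡-dec ℤ._≟_ ℤ._≟_ (fraction p) (+ a , + q)
            ×-dec (_ ℤ.≟ _) ×-dec side? b (δ p))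

        t²≤ : ∀ {b k p} → OnLine b k p →
              fromℕ (t k) * fromℕ (t k) ≤ δ p * δ p + (σ * σ + 4ₙ * (aᶠ * qᶠ) * H)
        t²≤ {p = m , n} o = ≤-resp-≈ (sym (*-cong (height o) (height o))) (+-congˡ (+-congʳ (sym σ²)))
          (by≤ (fromℕ-nonneg 4 ⊗ 0≤p ⊗ diff≤ (nm≤X+H (member o)))
            (solve 6 (λ a q m n X H →
              let δ = a :* m :- q :* n ; t = a :* m :+ q :* n ; f = con (+ 4) :* (a :* q) in
              δ :* δ :+ (f :* X :+ f :* H) :- t :* t := f :* (X :+ H :- n :* m)) refl aᶠ qᶠ (fromℤ m)
                  (fromℤ n) X H))

        ≤t² : ∀ {b k p} → OnLine b k p → δ p * δ p + σ * σ ≤ fromℕ (t k) * fromℕ (t k)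
        ≤t² {p = m , n} o = ≤-resp-≈ (+-congˡ (sym σ²)) (sym (*-cong (height o) (height o)))
          (by≤ (fromℕ-nonneg 4 ⊗ 0≤p ⊗ diff≤ (X≤nm (member o)))
            (solve 5 (λ a q m n X →
              let δ = a :* m :- q :* n ; t = a :* m :+ q :* n ; f = con (+ 4) :* (a :* q) in
              t :* t :- (δ :* δ :+ f :* X) := f :* (n :* m :- X)) refl aᶠ qᶠ (fromℤ m) (fromℤ n) X))

        between : ∀ {m n m₁ n₁ m₃ n₃} → S (m₁ , n₁) → S (m₃ , n₃) → fromℤ m₁ ≤ fromℤ m → fromℤ m ≤ fromℤ
            m₃ →
                  X < fromℤ n * fromℤ m → fromℤ n * fromℤ m ≤ X + H → S (m , n)
        between {m} {n} p₁ p₃ m₁≤m m≤m₃ X<π π≤ = point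
          ((before-≤ lowerClosed (proj₁ (proj₁ (S.in-region p₁))) m₁≤m , ≤-before upperClosed m≤m₃
              (proj₂ (proj₁ (S.in-region p₃))))
          , <-resp-≈ refl (sym (fromℤ-* n m)) X<π , ≤-resp-≈ (sym (fromℤ-* n m)) refl π≤)
          where open Interval J

        X<π : ∀ {m n} → S (m , n) → X < fromℤ n * fromℤ m
        X<π {m} {n} r = <-resp-≈ refl (fromℤ-* n m) (proj₁ (proj₂ (S.in-region r)))

        moveₘ-≤ : ∀ m i → fromℤ m ≤ fromℤ (m ℤ.+ + i ℤ.* + q)
        moveₘ-≤ m i = ≤-resp-≈ refl (sym (moveₘ m i)) (by≤ (fromℕ-nonneg i ⊗ fromℕ-nonneg q)
          (solve 2 (λ x y → x :+ y :- x := y) refl (fromℤ m) (fromℕ i * qᶠ)))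

        δ-step-≤ : ∀ p i → δ p ≤ δ (p +[ i ] v)
        δ-step-≤ p i = ≤-resp-≈ refl (sym (δ-step p i)) (by≤ (fromℕ-nonneg 2 ⊗ 0≤p ⊗ fromℕ-nonneg i)
          (solve 2 (λ x y → x :+ y :- x := y) refl (δ p) (2ₙ * (aᶠ * qᶠ) * fromℕ i)))

        line-step : ∀ m n i → + a ℤ.* (m ℤ.+ i ℤ.* + q) ℤ.+ + q ℤ.* (n ℤ.+ i ℤ.* ℤ.- + a) ≡ + a ℤ.* m
            ℤ.+ + q ℤ.* n
        line-step = identity (+ a) (+ q)
          where
          identity : ∀ a q m n i → a ℤ.* (m ℤ.+ i ℤ.* q) ℤ.+ q ℤ.* (n ℤ.+ i ℤ.* ℤ.- a) ≡ a ℤ.* m ℤ.+ q ℤ.* n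
          identity = ℤSolver.solve-∀

        onLine-convex : ∀ b {k} p i j → OnLine b k p → OnLine b k ((p +[ i ] v) +[ j ] v) → OnLine b k
            (p +[ i ] v)
        onLine-convex b {k} p@(m , n) i j o₁ o₃ = record
          { member = member₂ b (on-side o₁) (on-side o₃)
          ; served = convex i j (member o₁) (member₂ b (on-side o₁) (on-side o₃)) (member o₃)
              (served o₁) (served o₃)
          ; line = ≡.trans (line-step m n (+ i)) (line o₁)
          ; on-side = side₂ b (on-side o₁) (on-side o₃)
          }
          where
          p₂ = p +[ i ] v
          side₂ : ∀ b → side b (δ p) → side b (δ (p₂ +[ j ] v)) → side b (δ p₂)
          side₂ true  h _ = ≤-trans h (δ-step-≤ p i)
          side₂ false _ (lift h) = lift (≤-<-trans (δ-step-≤ p₂ j) h)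
          member₂ : ∀ b → side b (δ p) → side b (δ (p₂ +[ j ] v)) → S p₂
          -- For `δ ≥ 0` the bound `X < π` is inherited from the later end and `π ≤ X + H` from the
          -- earlier one; for `δ < 0` the roles are exchanged.
          member₂ true h₁ h₃ = between (member o₁) (member o₃) (moveₘ-≤ m i) (moveₘ-≤ (proj₁ p₂) j)
            (<-≤-trans (X<π (member o₃)) (π-decreasing p₂ j (side₂ true h₁ h₃)))
            (≤-trans (π-decreasing p i h₁) (nm≤X+H (member o₁)))
          member₂ false h₁ h₃ = between (member o₁) (member o₃) (moveₘ-≤ m i) (moveₘ-≤ (proj₁ p₂) j)
            (<-≤-trans (X<π (member o₁)) (π-increasing p i (<⇒≤ (Lift.lower (side₂ false h₁ h₃)))))
            (≤-trans (π-increasing p₂ j (<⇒≤ (Lift.lower h₃))) (nm≤X+H (member o₃)))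

        bezout = bézout a q (ℤ.+-injective coprime)
        α = proj₁ bezout
        β = proj₁ (proj₂ bezout)

        mBound = archimedean (2ₙ * M)
        nBound = archimedean (X + H)

        I₀ : ℕ
        I₀ = ℤ.∣ β ∣ ℕ.* proj₁ mBound ℕ.+ ℤ.∣ α ∣ ℕ.* proj₁ nBound

        -- The integer points of the line are `(α t + u q , β t - u a)`, where `u = β m - α n`. Over
        -- the region `|u| ≤ I₀`, so starting the ray at `u = -I₀` gives every relevant point a
        -- natural index.
        base : ℕ → ℤ²
        base k = α ℤ.* + t k ℤ.- + I₀ ℤ.* + q , β ℤ.* + t k ℤ.+ + I₀ ℤ.* + a

        abs-bound : ∀ {i n} → 1ℤ ℤ.≤ i → i ℤ.≤ + n → ℤ.∣ i ∣ ℕ.≤ n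
        abs-bound {+ i} _ (ℤ.+≤+ h) = h

        position-bound : ∀ {m n} → S (m , n) → ℤ.∣ β ℤ.* m ℤ.- α ℤ.* n ∣ ℕ.≤ I₀
        position-bound {m} {n} r = begin
          ℤ.∣ β ℤ.* m ℤ.- α ℤ.* n ∣                      ≤⟨ ℤ.∣i-j∣≤∣i∣+∣j∣ (β ℤ.* m) (α ℤ.* n) ⟩
          ℤ.∣ β ℤ.* m ∣ ℕ.+ ℤ.∣ α ℤ.* n ∣                ≡⟨ ≡.cong₂ (λ x y → x ℕ.+ y) (ℤ.abs-* β m)
              (ℤ.abs-* α n) ⟩
          ℤ.∣ β ∣ ℕ.* ℤ.∣ m ∣ ℕ.+ ℤ.∣ α ∣ ℕ.* ℤ.∣ n ∣    ≤⟨ ℕ.+-mono-≤ (ℕ.*-monoʳ-≤ ℤ.∣ β ∣ ∣m∣≤)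
              (ℕ.*-monoʳ-≤ ℤ.∣ α ∣ ∣n∣≤) ⟩
          I₀                                              ∎
          where
          open ℕ.≤-Reasoning
          ∣m∣≤ : ℤ.∣ m ∣ ℕ.≤ proj₁ mBound
          ∣m∣≤ = abs-bound (1≤-ℤ (0<m r)) (fromℤ-cancel-≤ {m} {+ proj₁ mBound}
              (≤-trans (m≤2M r) (<⇒≤ (proj₂ mBound))))
          ∣n∣≤ : ℤ.∣ n ∣ ℕ.≤ proj₁ nBound
          ∣n∣≤ = abs-bound (1≤-ℤ (0<n r)) (fromℤ-cancel-≤ {n} {+ proj₁ nBound}
              (≤-trans n≤nm (≤-trans (nm≤X+H r) (<⇒≤ (proj₂ nBound)))))
            where
            n≤nm : fromℤ n ≤ fromℤ n * fromℤ m
            n≤nm = by≤ (<⇒≤ (0<n r) ⊗ diff≤ (fromℤ-mono-≤ {1ℤ} {m} (1≤-ℤ (0<m r))))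
              (solve 2 (λ n m → n :* m :- n := n :* (m :- con (+ 1))) refl (fromℤ n) (fromℤ m))

        on-ray : ∀ {b k x} → OnLine b k x → ∃ λ u → u ℕ.< suc (I₀ ℕ.+ I₀) × x ≡ base k +[ u ] v
        on-ray {k = k} {x = m , n} o with nonneg-shift (β ℤ.* m ℤ.- α ℤ.* n) I₀ (position-bound (member o))
        ... | u , shift , u≤ = u , ℕ.s≤s u≤ , ≡.cong₂ _,_
          (≡.sym (begin
            α ℤ.* + t k ℤ.- + I₀ ℤ.* + q ℤ.+ + u ℤ.* + q
              ≡⟨ ≡.cong₂ (λ t u → α ℤ.* t ℤ.- + I₀ ℤ.* + q ℤ.+ u ℤ.* + q) (line o) shift ⟨
            α ℤ.* (+ a ℤ.* m ℤ.+ + q ℤ.* n) ℤ.- + I₀ ℤ.* + q ℤ.+ (β ℤ.* m ℤ.- α ℤ.* n ℤ.+ + I₀) ℤ.* + q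
              ≡⟨ ringₘ α β (+ a) (+ q) m n (+ I₀) ⟩
            (α ℤ.* + a ℤ.+ β ℤ.* + q) ℤ.* m
              ≡⟨ ≡.cong (λ e → e ℤ.* m) (proj₂ (proj₂ bezout)) ⟩
            1ℤ ℤ.* m
              ≡⟨ ℤ.*-identityˡ m ⟩
            m ∎))
          (≡.sym (begin
            β ℤ.* + t k ℤ.+ + I₀ ℤ.* + a ℤ.+ + u ℤ.* ℤ.- + a
              ≡⟨ ≡.cong₂ (λ t u → β ℤ.* t ℤ.+ + I₀ ℤ.* + a ℤ.+ u ℤ.* ℤ.- + a) (line o) shift ⟨
            β ℤ.* (+ a ℤ.* m ℤ.+ + q ℤ.* n) ℤ.+ + I₀ ℤ.* + a ℤ.+ (β ℤ.* m ℤ.- α ℤ.* n ℤ.+ + I₀) ℤ.* ℤ.- + a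
              ≡⟨ ringₙ α β (+ a) (+ q) m n (+ I₀) ⟩
            (α ℤ.* + a ℤ.+ β ℤ.* + q) ℤ.* n
              ≡⟨ ≡.cong (λ e → e ℤ.* n) (proj₂ (proj₂ bezout)) ⟩
            1ℤ ℤ.* n
              ≡⟨ ℤ.*-identityˡ n ⟩
            n ∎))
          where
          open ≡.≡-Reasoning
          ringₘ : ∀ α β a q m n I → α ℤ.* (a ℤ.* m ℤ.+ q ℤ.* n) ℤ.- I ℤ.* q ℤ.+
              (β ℤ.* m ℤ.- α ℤ.* n ℤ.+ I) ℤ.* q
                  ≡ (α ℤ.* a ℤ.+ β ℤ.* q) ℤ.* m
          ringₘ = ℤSolver.solve-∀
          ringₙ : ∀ α β a q m n I → β ℤ.* (a ℤ.* m ℤ.+ q ℤ.* n) ℤ.+ I ℤ.* a ℤ.+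
              (β ℤ.* m ℤ.- α ℤ.* n ℤ.+ I) ℤ.* ℤ.- a
                  ≡ (α ℤ.* a ℤ.+ β ℤ.* q) ℤ.* n
          ringₙ = ℤSolver.solve-∀

        ray-injective : ∀ p {i j} → p +[ i ] v ≡ p +[ j ] v → i ≡ j
        ray-injective (x , y) {i} {j} eq = ℤ.+-injective
            (ℤ.*-cancelʳ-≡ (+ i) (+ j) (+ q) (∙-cancelˡ x _ _ (≡.cong proj₁ eq)))
          where
          open import Algebra.Properties.Group (AbelianGroup.group ℤ.+-0-abelianGroup) using (∙-cancelˡ)

        rewrite-step : ∀ p {i j} → i ℕ.≤ j → (p +[ i ] v) +[ j ℕ.∸ i ] v ≡ p +[ j ] v
        rewrite-step p {i} {j} i≤j = ≡.trans (+[]-assoc p i (j ℕ.∸ i) v)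
            (≡.cong (λ u → p +[ u ] v) (ℕ.m+[n∸m]≡n i≤j))

        ray-convex : ∀ b {k} p {i j l} → i ℕ.≤ j → j ℕ.≤ l →
          OnLine b k (p +[ i ] v) → OnLine b k (p +[ l ] v) → OnLine b k (p +[ j ] v)
        ray-convex b {k} p {i} {j} {l} i≤j j≤l o₁ o₃ = ≡.subst (OnLine b k) (rewrite-step p i≤j)
          (onLine-convex b (p +[ i ] v) (j ℕ.∸ i) (l ℕ.∸ j) o₁
            (≡.subst (OnLine b k) (≡.sym (≡.trans (≡.cong (λ p → p +[ l ℕ.∸ j ] v) (rewrite-step p i≤j))
                (rewrite-step p j≤l))) o₃))

        onLine-apart : ∀ {b j k x} → OnLine b j x → OnLine b k x → j ≡ k
        onLine-apart o o′ = ℕ.+-cancelˡ-≡ (suc s₀) _ _ (ℤ.+-injective (≡.trans (≡.sym (line o)) (line o′)))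

        den = X * (fromℕ Q * fromℕ Q) * qᶠ

        U : Carrier
        U = M ^ 3 / (X * fromℤ (+ Q) ^ 2 * fromℤ (+ q))

        1≤qᶠ : fromℕ 1 ≤ qᶠ
        1≤qᶠ = fromℤ-mono-≤ 1≤q

        q≤Qᶠ : qᶠ ≤ fromℕ Q
        q≤Qᶠ = fromℤ-mono-≤ q≤Q

        0<den : 0# < den
        0<den = 0<X ⊠ (0<Q ⊠ 0<Q) ⊠ <-≤-trans (fromℕ-pos 0) 1≤qᶠ
          where 0<Q = <-≤-trans (fromℕ-pos 0) 1≤Q

        U*den : U * den ≈ M * M * M
        U*den = trans (*-congˡ (solve 3 (λ X Q q → X :* (Q :* Q) :* q := X :* Q :^ 2 :* q) refl X
            (fromℕ Q) qᶠ))
          (trans (/-cancel (<-resp-≈ refl (solve 3 (λ X Q q → X :* (Q :* Q) :* q := X :* Q :^ 2 :* q)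
              refl X (fromℕ Q) qᶠ) 0<den))
            (solve 1 (λ M → M :^ 3 := M :* M :* M) refl M))

        0≤κ : 0# ≤ κ
        0≤κ = fromℕ-nonneg 3 ⊕ <⇒≤ 0<D

        0≤K² : 0# ≤ K * K
        0≤K² = sq-nonneg K

        -- The sum of the constants for `e² k`, which is 32, and for `k`, which is `4 κ + K²`. It
        -- also exceeds the 8 of the line `k = 0`, so the single bound `V` serves all three.
        C′ : Carrier
        C′ = 32ₙ + (4ₙ * κ + K * K)

        0≤M³ : 0# ≤ M * M * M
        0≤M³ = sq-nonneg M ⊗ <⇒≤ 0<M

        1≤U′ : fromℕ 1 ≤ U
        1≤U′ = ≤-cancelˡ 0<den (≤-resp-≈ (solve 1 (λ x → x := x :* con (+ 1)) refl den)
            (sym (trans (*-comm den U) U*den))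
          (1≤U 0<X 0<H 0<M 0≤w 1≤Q X≤H³ w⁴≈HX Qw≤M 1≤qᶠ q≤Qᶠ))

        abstract
          bounded : ∃ λ n → fromℕ n ≤ C′ * U × C′ * U < fromℕ (suc n)
          bounded = floor {C′ * U} ((fromℕ-nonneg 32 ⊕ (fromℕ-nonneg 4 ⊗ 0≤κ ⊕ 0≤K²)) ⊗ ≤-trans
              (fromℕ-nonneg 1) 1≤U′)

        V : ℕ
        V = proj₁ bounded

        ≤V : ∀ {n x} → 0# ≤ C′ - x → fromℕ n * den ≤ x * (M * M * M) → n ℕ.≤ V
        ≤V {n} {x} x≤C′ h = ℕ.s≤s⁻¹ (fromℕ-cancel-< (≤-<-trans n≤C′U (proj₂ (proj₂ bounded))))
          where
          n≤C′U : fromℕ n ≤ C′ * U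
          n≤C′U = ≤-cancelˡ 0<den (≤-resp-≈ (*-comm _ _)
            (trans (*-congˡ (sym U*den)) (solve 3 (λ c u d → c :* (u :* d) := d :* (c :* u)) refl C′ U den))
            (≤-trans h (by≤ (x≤C′ ⊗ 0≤M³) (solve 3 (λ c x m → c :* m :- x :* m := (c :- x) :* m) refl C′
                x (M * M * M)))))

        line-index-bound : ∀ {b k p} → OnLine b k p → k ℕ.≤ V
        line-index-bound {b} {k} {p} o = ≤V
          (≤-trans (fromℕ-nonneg 32) (inj₂ (solve 2 (λ s x → s := s :+ x :- x) refl 32ₙ (4ₙ * κ + K * K))))
          (line-bound 0<X 0<H 0<M 0≤w 1≤Q X≤H³ w⁴≈HX Qw≤M 1≤qᶠ q≤Qᶠ 0<a 0≤σ 0≤κ σ² Xq≤ ≤κXq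
            (fromℕ-nonneg k) (σ+k≤t k) {δ p} {K * K} (t²≤ o) (close (member o) (served o)))

        on-some-line : ∀ {p} → S p → fraction p ≡ (+ a , + q) → ∃ λ b → ∃ λ k → k ℕ.< suc V × OnLine b k p
        on-some-line {p@(m , n)} r f = choose (≤-or-> 0# (δ p))
          where
          τ = + a ℤ.* m ℤ.+ + q ℤ.* n
          τᶠ : fromℤ τ ≈ aᶠ * fromℤ m + qᶠ * fromℤ n
          τᶠ = trans (fromℤ-+ (+ a ℤ.* m) (+ q ℤ.* n)) (+-cong (fromℤ-* (+ a) m) (fromℤ-* (+ q) n))
          0≤τ : 0# ≤ fromℤ τ
          0≤τ = ≤-resp-≈ refl (sym τᶠ) (fromℕ-nonneg a ⊗ <⇒≤ (0<m r) ⊕ fromℕ-nonneg q ⊗ <⇒≤ (0<n r))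
          σ²<τ² : σ * σ < fromℤ τ * fromℤ τ
          σ²<τ² = <-resp-≈ (sym σ²) (sym (*-cong τᶠ τᶠ))
            (by< (fromℕ-pos 3 ⊠ (0<a ⊠ <-≤-trans (fromℕ-pos 0) 1≤qᶠ) ⊠ diff< (X<π r) ⊞ sq-nonneg (δ p))
              (solve 5 (λ a q m n X → let t = a :* m :+ q :* n ; f = con (+ 4) :* (a :* q) ; δ = a :* m :- q :* n in
                t :* t :- f :* X := f :* (n :* m :- X) :+ δ :* δ) refl aᶠ qᶠ (fromℤ m) (fromℤ n) X))
          s₀<τ : + s₀ ℤ.< τ
          s₀<τ with ≤-or-> (fromℤ τ) σ
          ... | inj₁ τ≤σ = ⊥-elim (≤⇒≯ (*-mono-≤ 0≤τ 0≤τ τ≤σ τ≤σ) σ²<τ²)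
          ... | inj₂ σ<τ = fromℤ-cancel-< {+ s₀} {τ} (≤-<-trans (proj₁ (proj₂ (floor 0≤σ))) σ<τ)
          index : ∀ {τ} → + s₀ ℤ.< τ → ∃ λ k → τ ≡ + t k
          index {+ x} (ℤ.+<+ h) = x ℕ.∸ suc s₀ , ≡.cong +_ (≡.sym (ℕ.m+[n∸m]≡n h))
          located = index s₀<τ
          on : ∀ b → side b (δ p) → ∃ λ b → ∃ λ k → k ℕ.< suc V × OnLine b k p
          on b s = b , proj₁ located , ℕ.s≤s (line-index-bound o) , o
            where
            o : OnLine b (proj₁ located) p
            o = record { member = r ; served = f ; line = proj₂ located ; on-side = s }
          choose : _ → _
          choose (inj₁ h) = on true h
          choose (inj₂ h) = on false (lift h)

        run-bounds : ∀ b {k} p e → OnLine b k p → OnLine b k (p +[ e ℕ.* L ] v) →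
                     e ℕ.≤ V × e ℕ.* e ℕ.* k ℕ.≤ V
        run-bounds b {k} p e o o′ = by-side b (on-side o) (on-side o′)
          where
          eL : δ (p +[ e ℕ.* L ] v) ≈ δ p + 2ₙ * (aᶠ * qᶠ) * fromℕ L * fromℕ e
          eL = trans (δ-step p (e ℕ.* L)) (+-congˡ (trans (*-congˡ (fromℕ-* e L))
            (solve 3 (λ x e L → x :* (e :* L) := x :* L :* e) refl (2ₙ * (aᶠ * qᶠ)) (fromℕ e) (fromℕ L))))
          e²k : fromℕ (e ℕ.* e ℕ.* k) ≈ fromℕ e * fromℕ e * fromℕ k
          e²k = trans (fromℕ-* (e ℕ.* e) k) (*-congʳ (fromℕ-* e e))
          bounds : ∀ {y} → 0# ≤ y → fromℕ (t k) * fromℕ (t k) ≤ y * y + (σ * σ + 4ₙ * (aᶠ * qᶠ) * H) →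
            (let z = y + 2ₙ * (aᶠ * qᶠ) * fromℕ L * fromℕ e in z * z + σ * σ ≤ fromℕ (t k) * fromℕ (t k)) →
            e ℕ.≤ V × e ℕ.* e ℕ.* k ℕ.≤ V
          bounds 0≤y h h′ =
            ≤V (≤-trans (fromℕ-nonneg 24 ⊕ 0≤4κ+K²)
                (inj₂ (solve 1 (λ x → con (+ 24) :+ x := con (+ 32) :+ x :- con (+ 8)) refl
                    (4ₙ * κ + K * K))))
              (first-run-bound 0<X 0<H 0<M 0≤w 1≤Q X≤H³ w⁴≈HX Qw≤M 1≤qᶠ q≤Qᶠ 0<a 0≤σ 0≤κ σ² Xq≤ ≤κXq
                (fromℕ-nonneg k) (σ+k≤t k) 0≤y (fromℕ-nonneg e) (fromℕ-nonneg L) HQ≤2LM h h′) ,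
            ≤V (≤-trans 0≤4κ+K² (inj₂ (solve 1 (λ x → x := con (+ 32) :+ x :- con (+ 32)) refl
                (4ₙ * κ + K * K))))
              (≤-resp-≈ (*-congʳ (sym e²k)) refl
                (run-bound 0<X 0<H 0<M 0≤w 1≤Q X≤H³ w⁴≈HX Qw≤M 1≤qᶠ q≤Qᶠ 0<a 0≤σ 0≤κ σ² Xq≤ ≤κXq
                  (fromℕ-nonneg k) (σ+k≤t k) 0≤y (fromℕ-nonneg e) (fromℕ-nonneg L) HQ≤2LM h h′))
            where
            0≤4κ+K² : 0# ≤ 4ₙ * κ + K * K
            0≤4κ+K² = fromℕ-nonneg 4 ⊗ 0≤κ ⊕ 0≤K²
          by-side : ∀ b → side b (δ p) → side b (δ (p +[ e ℕ.* L ] v)) → e ℕ.≤ V × e ℕ.* e ℕ.* k ℕ.≤ V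
          by-side true 0≤δ _ = bounds 0≤δ (t²≤ o) (≤-resp-≈ (+-congʳ (*-cong eL eL)) refl (≤t² o′))
          -- On the negative side `|δ|` grows backwards, so the run is read from its later end, with
          -- `y = - δ` there.
          by-side false _ (lift δ′<0) = bounds { - δ (p +[ e ℕ.* L ] v)}
            (≤-resp-≈ refl (+-identityˡ _) (diff≤ (<⇒≤ δ′<0)))
            (≤-resp-≈ refl (+-congʳ (solve 1 (λ x → x :* x := :- x :* :- x) refl
                (δ (p +[ e ℕ.* L ] v)))) (t²≤ o′))
            (≤-resp-≈ (+-congʳ (trans (solve 2
                (λ x ℓ → x :* x := (:- (x :+ ℓ) :+ ℓ) :* (:- (x :+ ℓ) :+ ℓ)) refl (δ p)
                    (2ₙ * (aᶠ * qᶠ) * fromℕ L * fromℕ e))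
              (*-cong negate negate))) refl (≤t² o))
            where
            negate : - (δ p + 2ₙ * (aᶠ * qᶠ) * fromℕ L * fromℕ e) + 2ₙ * (aᶠ * qᶠ) * fromℕ L * fromℕ e
                     ≈ - δ (p +[ e ℕ.* L ] v) + 2ₙ * (aᶠ * qᶠ) * fromℕ L * fromℕ e
            negate = +-congʳ (-‿cong (sym eL))

        abstract
          line-tiling : ∀ b k → Σ[ T ∈ Tiling (OnLine b k) v L ] (length (Tiling.tiles T) ≡ 0 ⊎
            ∃₂ λ e i → length (Tiling.tiles T) ≡ suc e × OnLine b k (base k +[ i ] v) × OnLine b k
                (base k +[ i ℕ.+ e ℕ.* L ] v))
          line-tiling b k = ray-tiling {v = v} L {R = OnLine b k} (base k) (ray-injective (base k))
            (λ i → onLine? b k (base k +[ i ] v)) (ray-convex b (base k)) (suc (I₀ ℕ.+ I₀)) on-ray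

        tiling : ∀ b k → Tiling (OnLine b k) v L
        tiling b k = proj₁ (line-tiling b k)

        -- The blocks beyond the first; `pred` gives an empty run excess 0.
        excess : Bool → ℕ → ℕ
        excess b k = ℕ.pred (length (Tiling.tiles (tiling b k)))

        excess-bound : ∀ b k → excess b k ℕ.≤ V × excess b k ℕ.* excess b k ℕ.* k ℕ.≤ V
        excess-bound b k = bound (proj₂ (line-tiling b k))
          where
          bound : ∀ {l} → (l ≡ 0 ⊎ ∃₂ λ e i → l ≡ suc e × OnLine b k (base k +[ i ] v) × OnLine b k
              (base k +[ i ℕ.+ e ℕ.* L ] v)) →
                  ℕ.pred l ℕ.≤ V × ℕ.pred l ℕ.* ℕ.pred l ℕ.* k ℕ.≤ V
          bound (inj₁ ≡.refl) = ℕ.z≤n , ℕ.z≤n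
          bound (inj₂ (e , i , ≡.refl , o , o′)) = run-bounds b (base k +[ i ] v) e o
            (≡.subst (OnLine b k) (≡.sym (+[]-assoc (base k) i (e ℕ.* L) v)) o′)

        side-tiling : ∀ b → Tiling (λ x → ∃ λ k → k ℕ.< suc V × OnLine b k x) v L
        side-tiling b = joins (OnLine b) onLine-apart (tiling b) (suc V)

        side-count : ∀ b → length (Tiling.tiles (side-tiling b)) ℕ.≤ 4 ℕ.* V ℕ.+ 1
        side-count b = begin
          length (Tiling.tiles (side-tiling b))
            ≡⟨ length-joins (OnLine b) onLine-apart (tiling b) (suc V) ⟩
          ∑< (suc V) (λ k → length (Tiling.tiles (tiling b k)))
            ≤⟨ ∑<-mono (suc V) (λ {k} _ → n≤1+pred[n] (length (Tiling.tiles (tiling b k)))) ⟩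
          ∑< (suc V) (λ k → suc (excess b k))
            ≡⟨ ∑<-suc (suc V) (excess b) ⟩
          suc V ℕ.+ ∑< (suc V) (excess b)
            ≡⟨ ≡.cong (λ x → suc V ℕ.+ x) (∑<-head V (excess b)) ⟩
          suc V ℕ.+ (excess b 0 ℕ.+ ∑< V (λ k → excess b (suc k)))
            ≤⟨ ℕ.+-monoʳ-≤ (suc V) (ℕ.+-mono-≤ (proj₁ (excess-bound b 0))
                 (∑-inverse-sqrt V (λ k → excess b (suc k)) (λ {k} _ → proj₂ (excess-bound b (suc k))))) ⟩
          suc V ℕ.+ (V ℕ.+ 2 ℕ.* V)
            ≡⟨ total V ⟩
          4 ℕ.* V ℕ.+ 1 ∎
          where
          open ℕ.≤-Reasoning
          total : ∀ V → suc V ℕ.+ (V ℕ.+ 2 ℕ.* V) ≡ 4 ℕ.* V ℕ.+ 1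
          total = ℕSolver.solve-∀

      Served : Pred ℤ² (ℓ₁ ⊔ ℓ₂)
      Served p = S p × fraction p ≡ (+ a , + q)

      private
        served-tiling : Tiling Served v L
        served-tiling = retile from to (join opposite (side-tiling true) (side-tiling false))
          where
          opposite : ∀ {x} → (∃ λ k → k ℕ.< suc V × OnLine true k x) →
              (∃ λ k → k ℕ.< suc V × OnLine false k x) → ⊥
          opposite (_ , _ , o) (_ , _ , o′) = ≤⇒≯ (on-side o) (Lift.lower (on-side o′))
          from : _ ⊆ Served
          from (inj₁ (_ , _ , o)) = member o , served o
          from (inj₂ (_ , _ , o)) = member o , served o
          to : Served ⊆ _
          to (r , f) with on-some-line r f
          ... | true  , located = inj₁ located
          ... | false , located = inj₂ located

        served-count : fromℕ (length (Tiling.tiles served-tiling)) ≤ (8ₙ * C′ + 2ₙ) * U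
        served-count = ≤-trans (fromℕ-mono-≤ count) (≤-resp-≈ (sym homo) refl
          (by≤ (fromℕ-nonneg 8 ⊗ diff≤ (proj₁ (proj₂ bounded)) ⊕ fromℕ-nonneg 2 ⊗ diff≤ 1≤U′)
            (solve 3 (λ C U V → (con (+ 8) :* C :+ con (+ 2)) :* U :- (con (+ 8) :* V :+ con (+ 2))
              := con (+ 8) :* (C :* U :- V) :+ con (+ 2) :* (U :- con (+ 1))) refl C′ U (fromℕ V))))
          where
          count : length (Tiling.tiles served-tiling) ℕ.≤ 8 ℕ.* V ℕ.+ 2
          count = begin
            length (Tiling.tiles served-tiling)  ≡⟨ length-++ (Tiling.tiles (side-tiling true)) ⟩
            length (Tiling.tiles (side-tiling true)) ℕ.+ length (Tiling.tiles (side-tiling false))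
                                                 ≤⟨ ℕ.+-mono-≤ (side-count true) (side-count false) ⟩
            (4 ℕ.* V ℕ.+ 1) ℕ.+ (4 ℕ.* V ℕ.+ 1)  ≡⟨ total V ⟩
            8 ℕ.* V ℕ.+ 2 ∎
            where
            open ℕ.≤-Reasoning
            total : ∀ V → (4 ℕ.* V ℕ.+ 1) ℕ.+ (4 ℕ.* V ℕ.+ 1) ≡ 8 ℕ.* V ℕ.+ 2
            total = ℕSolver.solve-∀
          homo : fromℕ (8 ℕ.* V ℕ.+ 2) ≈ 8ₙ * fromℕ V + 2ₙ
          homo = trans (fromℕ-+ (8 ℕ.* V) 2) (+-congʳ (fromℕ-* 8 V))

      abstract
        counted-tiling : Σ[ T ∈ Tiling Served v L ] fromℕ (length (Tiling.tiles T)) ≤ constant D *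
            (M ^ 3 / (X * fromℤ (+ Q) ^ 2 * fromℤ (+ q)))
        counted-tiling = served-tiling , served-count

-- Assembling the decomposition

module Main {c ℓ₁ ℓ₂} (ℝ : RealField c ℓ₁ ℓ₂) where
  open RealField ℝ
  open Hyperbola ℝ
  open OrderedField ℝ
  open Estimates ℝ
  open Assignments ℝ
  open LineTilings ℝ
  open Solver using (solve; _:+_; _:*_; _:-_; _:^_; _:=_; con)

  0<1/16 : 0# < 1# / 16ₙ
  0<1/16 = <-cancelˡ (fromℕ-nonneg 16) (<-resp-≈ (sym (zeroʳ 16ₙ))
      (trans (sym (/-cancel (fromℕ-pos 15))) (*-comm _ _)) 0<1)

  1/16< : ∀ {D} → 0# < D → 1# / 16ₙ < 3ₙ + D
  1/16< {D} 0<D = <-cancelˡ (fromℕ-nonneg 16)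
      (<-resp-≈ (trans (sym (/-cancel (fromℕ-pos 15))) (*-comm _ _)) refl
    (<-resp-≈ fromℤ-1 refl (by< (fromℕ-pos 46 ⊞ fromℕ-nonneg 16 ⊗ <⇒≤ 0<D)
      (solve 1 (λ D → con (+ 16) :* (con (+ 3) :+ D) :- con (+ 1) := con (+ 47) :+ con (+ 16) :* D) refl
          D))))

  0<constant : ∀ {D} → 0# < D → 0# < constant D
  0<constant 0<D = ≤-<-trans (fromℕ-nonneg 8 ⊗
      (fromℕ-nonneg 32 ⊕ (fromℕ-nonneg 4 ⊗ (fromℕ-nonneg 3 ⊕ <⇒≤ 0<D) ⊕ sq-nonneg _)))
    (by< (fromℕ-pos 1) (solve 1 (λ x → x :+ con (+ 2) :- x := con (+ 2)) refl _))

  module _ {X H M w D : Carrier} (0<X : 0# < X) (0<H : 0# < H) (0<M : 0# < M) (0<D : 0# < D) (H≤X : H ≤ X)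
    (M²≤DX : M * M ≤ D * X) (Q : ℕ) .{{_ : ℕ.NonZero Q}} (J : Interval)
        (J⊆ : within J ⊆ within ⦅ M , 2# * M ⦆ˡ)
    (0≤w : 0# ≤ w) (X≤H³ : X ≤ H * H * H) (w⁴≈HX : w * w * w * w ≈ H * X) (Qw≤M : fromℕ Q * w ≤ M)
    (L : ℕ) .{{_ : ℕ.NonZero L}} (HQ≤2LM : H * fromℕ Q ≤ 2ₙ * fromℕ L * M)
        (L≤ : fromℕ L ≤ H * fromℤ (+ Q) / M) where

    open Setting 0<X 0<H 0<M 0<D H≤X M²≤DX Q J J⊆

    private
      abstract
        assignment : Assignment
        assignment with ≤-or-> (8ₙ * (M * M)) (fromℕ Q * X)
        ... | inj₁ fine   = fineAssignment fine
        ... | inj₂ coarse = coarseAssignment (<⇒≤ coarse)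

      open Assignment assignment

      Tiled : ℤ → ℤ → List Progression → Set _
      Tiled a q Ps = Σ[ T ∈ Tiling (λ p → S p × fraction p ≡ (a , q)) (q , ℤ.- a) L ]
        (Tiling.tiles T ≡ Ps × fromℕ (length Ps) ≤ constant D * (M ^ 3 / (X * fromℤ (+ Q) ^ 2 * fromℤ q)))

      abstract
        tiled : ∀ a q → 1ℤ ℤ.≤ a → 1ℤ ℤ.≤ q → Admissible′ a q → ∃ (Tiled a q)
        tiled (+ suc a) (+ suc q) _ _ adm =
          let T , count = counted-tiling 0<X 0<H 0<M 0<D H≤X M²≤DX Q J J⊆ 0≤w X≤H³ w⁴≈HX Qw≤M L HQ≤2LM assignment (suc a) (suc q) adm
          in Tiling.tiles T , T , ≡.refl , count
        tiled (+ zero)  _        (ℤ.+≤+ ()) _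
        tiled (+ suc _) (+ zero) _ (ℤ.+≤+ ())

        -- The family has to be defined on all pairs; deciding admissibility allows the empty list
        -- elsewhere.
        blocks : ∀ a q → Σ[ Ps ∈ List Progression ] (Admissible′ a q → Tiled a q Ps)
        blocks a q = decide (admissible? a q)
          where
          decide : Dec (Admissible′ a q) → Σ[ Ps ∈ List Progression ] (Admissible′ a q → Tiled a q Ps)
          decide (yes adm) = let Ps , T = tiled a q (Admissible′.1≤a adm) (Admissible′.1≤q adm) adm in
              Ps , λ _ → T
          decide (no ¬adm) = [] , λ adm → ⊥-elim (¬adm adm)

      family : ℤ × ℤ → List Progression
      family (a , q) = proj₁ (blocks a q)

    -- A point of a block recovers the pair `(a , q)` as its assigned fraction. So blocks of
    -- different pairs cannot meet, and blocks of one pair are separated by its tiling.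
    decomposition : Decomposition (1# / 16ₙ) (3ₙ + D) (constant D) X H M J (+ Q)
    decomposition = record
      { family = family
      ; partition = record
        { nonempty = λ { {(a , q) , P} (adm , P∈) → let T , eq , _ = tiling adm in Tiling.nonempty T
            (≡.subst (P ∈ₗ_) (≡.sym eq) P∈) }
        ; contained = λ { {(a , q) , P} (adm , P∈) x∈ → S.in-region (proj₁ (served adm P∈ x∈)) }
        ; covers = λ {x} x∈ → covers (point x∈)
        ; disjoint = λ { {(a , q) , P} {(a′ , q′) , P′} (adm , P∈) (adm′ , P′∈) x∈ x∈′ →
            disjoint adm adm′ (≡.trans (≡.sym (proj₂ (served adm P∈ x∈))) (proj₂ (served adm′ P′∈ x∈′)))
                P∈ P′∈ x∈ x∈′ }
        }
      ; count = λ adm → let _ , _ , bound = tiling adm in bound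
      ; spacing = λ {a} {q} {P} (adm , P∈) → let T , eq , _ = tiling adm in Tiling.spacing T
          (≡.subst (P ∈ₗ_) (≡.sym eq) P∈)
      ; len = λ {a} {q} {P} (adm , P∈) → let T , eq , _ = tiling adm in
          ≤-trans (fromℕ-mono-≤ (Tiling.short T (≡.subst (P ∈ₗ_) (≡.sym eq) P∈))) L≤
      }
      where
      open import Data.List.Membership.Propositional using () renaming (_∈_ to _∈ₗ_)
      Adm = Admissible (1# / 16ₙ) (3ₙ + D) X M (+ Q)

      tiling : ∀ {a q} → Adm (a , q) → Tiled a q (family (a , q))
      tiling {a} {q} adm = proj₂ (blocks a q) (fromAdmissible adm)

      served : ∀ {a q P x} → Adm (a , q) → P ∈ₗ family (a , q) → points P x → S x × fraction x ≡ (a , q)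
      served {P = P} adm P∈ x∈ = let T , eq , _ = tiling adm in Tiling.contained T
          (≡.subst (P ∈ₗ_) (≡.sym eq) P∈) x∈

      covers : ∀ {x} → S x → ∃ λ ((aq , P) : (ℤ × ℤ) × Progression) → (Adm aq × P ∈ₗ family aq) × points P x
      covers {x} x∈ =
        let adm = toAdmissible (admissible x∈ ≡.refl)
            T , eq , _ = tiling adm
            P , P∈ , x∈P = Tiling.covers T (x∈ , ≡.refl)
        in (fraction x , P) , (adm , ≡.subst (P ∈ₗ_) eq P∈) , x∈P

      disjoint : ∀ {a q a′ q′ P P′ x} → Adm (a , q) → Adm (a′ , q′) → (a , q) ≡ (a′ , q′) →
                 P ∈ₗ family (a , q) → P′ ∈ₗ family (a′ , q′) → points P x → points P′ x →
                 ((a , q) , P) ≡ ((a′ , q′) , P′)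
      disjoint {P = P} {P′} adm _ ≡.refl P∈ P′∈ x∈ x∈′ = let T , eq , _ = tiling adm in
        ≡.cong (_ ,_) (Tiling.disjoint T (≡.subst (P ∈ₗ_) (≡.sym eq) P∈)
            (≡.subst (P′ ∈ₗ_) (≡.sym eq) P′∈) x∈ x∈′)

  cube-bound : ∀ {X H} → 0# ≤ X → X ^1/ 3 ≤ H → X ≤ H * H * H
  cube-bound {X} {H} 0≤X h = ≤-resp-≈ (trans (solve 1 (λ r → r :* r :* r := r :^ 3) refl (X ^1/ 3))
      (^1/-root 3 0≤X)) refl
    (*-mono-≤ (0≤r ⊗ 0≤r) 0≤r (*-mono-≤ 0≤r 0≤r h h) h)
    where 0≤r = ^1/-nonNeg 3 0≤X

  -- `C₀²` alone would bound `M²`; the added 1 makes the factor positive for every `C₀`, so it can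
  -- serve as `D`.
  square-bound : ∀ {X M C₀} → 0# ≤ X → 0# ≤ M → M ≤ C₀ * X ^1/ 2 → M * M ≤ (C₀ * C₀ + 1#) * X
  square-bound {X} {M} {C₀} 0≤X 0≤M h = ≤-trans (*-mono-≤ 0≤M 0≤M h h)
    (≤-resp-≈ (trans (*-congˡ (sym (^1/-root 2 0≤X)))
        (solve 2 (λ c r → c :* c :* r :^ 2 := c :* r :* (c :* r)) refl C₀ (X ^1/ 2))) refl
      (by≤ 0≤X (trans (+-congʳ (trans (distribʳ X (C₀ * C₀) 1#) (+-congˡ (*-identityˡ X))))
        (solve 2 (λ y x → y :+ x :- y := x) refl (C₀ * C₀ * X) X))))

  0<C₀²+1 : ∀ C₀ → 0# < C₀ * C₀ + 1#
  0<C₀²+1 C₀ = <-resp-≈ refl (+-comm _ _) (0<1 ⊞ sq-nonneg C₀)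

  decompose : (C₀ X H M : Carrier) → 1# ≤ X → 1# ≤ H → 1# ≤ M →
    X ^1/ 3 ≤ H → H ≤ X → M ≤ C₀ * X ^1/ 2 →
    (J : Interval) → within J ⊆ within ⦅ M , 2# * M ⦆ˡ →
    (Q : ℤ) → M / H ≤ fromℤ Q → fromℤ Q ≤ M / (H * X) ^1/ 4 →
    let D = C₀ * C₀ + 1# in
    Decomposition (1# / 16ₙ) (3ₙ + D) (constant D) X H M J Q
  decompose C₀ X H M 1≤X 1≤H 1≤M X≤ H≤X M≤ J J⊆ Q Q≥ Q≤ = go Q (1≤-ℤ 0<Q) M≤HQ Qw≤M
    where
    0<X = 1≤⇒0< 1≤X
    0<H = 1≤⇒0< 1≤H
    0<M = 1≤⇒0< 1≤M
    w = (H * X) ^1/ 4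
    0<HX = 0<H ⊠ 0<X

    w⁴ : w * w * w * w ≈ H * X
    w⁴ = trans (solve 1 (λ w → w :* w :* w :* w := w :^ 4) refl w) (^1/-root 4 (<⇒≤ 0<HX))

    0≤w : 0# ≤ w
    0≤w = ^1/-nonNeg 4 (<⇒≤ 0<HX)

    0<w : 0# < w
    0<w with 0≤w
    ... | inj₁ h = h
    ... | inj₂ h = ⊥-elim (<-irrefl (<-resp-≈ refl (trans (sym w⁴) (trans (*-congˡ (sym h)) (zeroʳ _)))
        0<HX))

    scale : ∀ {x y z} → 0# < z → x ≤ y → x * z ≤ y * z
    scale {x} {y} {z} 0<z h = by≤ (diff≤ h ⊗ <⇒≤ 0<z)
        (solve 3 (λ x y z → y :* z :- x :* z := (y :- x) :* z) refl x y z)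

    M≤HQ : M ≤ H * fromℤ Q
    M≤HQ = ≤-resp-≈ (/-cancel 0<H) (*-comm _ _) (scale 0<H Q≥)

    Qw≤M : fromℤ Q * w ≤ M
    Qw≤M = ≤-resp-≈ refl (/-cancel 0<w) (scale 0<w Q≤)

    0<Q : 0# < fromℤ Q
    0<Q = <-cancelˡ (<⇒≤ 0<H) (<-resp-≈ (sym (zeroʳ H)) refl (<-≤-trans 0<M M≤HQ))

    go : ∀ Q → 1ℤ ℤ.≤ Q → M ≤ H * fromℤ Q → fromℤ Q * w ≤ M →
         Decomposition (1# / 16ₙ) (3ₙ + (C₀ * C₀ + 1#)) (constant (C₀ * C₀ + 1#)) X H M J Q
    go (+ zero) (ℤ.+≤+ ())
    go (+ suc Q) _ M≤HQ Qw≤M = with-length (floor (≤-trans (<⇒≤ 0<1) 1≤HQ/M))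
      where
      y = H * fromℤ (+ suc Q) / M

      y*M : y * M ≈ H * fromℤ (+ suc Q)
      y*M = /-cancel 0<M

      1≤HQ/M : 1# ≤ y
      1≤HQ/M = ≤-cancelˡ 0<M (≤-resp-≈ (sym (*-identityʳ M)) (trans (sym y*M) (*-comm y M)) M≤HQ)

      with-length : (∃ λ n → fromℕ n ≤ y × y < fromℕ (suc n)) →
                    Decomposition (1# / 16ₙ) (3ₙ + (C₀ * C₀ + 1#)) (constant (C₀ * C₀ + 1#)) X H M J
                        (+ suc Q)
      with-length (zero , _ , y<1) = ⊥-elim (≤⇒≯ 1≤HQ/M (<-resp-≈ refl fromℤ-1 y<1))
      -- The block length is `⌊H Q / M⌋`, the largest permitted. It is not 0 because `M ≤ H Q`, and
      -- then `H Q / M` is below the length plus 1, hence at most twice the length.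
      with-length (suc L , L≤y , y<1+L) =
        decomposition 0<X 0<H 0<M (0<C₀²+1 C₀) H≤X (square-bound (<⇒≤ 0<X) (<⇒≤ 0<M) M≤) (suc Q) J J⊆
          0≤w (cube-bound (<⇒≤ 0<X) X≤) w⁴ Qw≤M (suc L) HQ≤2LM L≤y
        where
        1≤1+L : fromℕ 1 ≤ fromℕ (suc L)
        1≤1+L = fromℕ-mono-≤ {1} {suc L} (ℕ.s≤s ℕ.z≤n)
        HQ≤2LM : H * fromℕ (suc Q) ≤ 2ₙ * fromℕ (suc L) * M
        HQ≤2LM = ≤-resp-≈ y*M refl (by≤ ((diff≤ (<⇒≤ y<1+L) ⊕ diff≤ 1≤1+L) ⊗ <⇒≤ 0<M)
          (trans (solve 3 (λ y L M → con (+ 2) :* L :* M :- y :* M :=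
              (con (+ 1) :+ L :- y :+ (L :- con (+ 1))) :* M) refl y (fromℕ (suc L)) M)
            (*-congʳ (+-congʳ (+-congʳ (+-congʳ fromℤ-1))))))

theorem8p1 : ∀ {c ℓ₁ ℓ₂} (ℝ : RealField c ℓ₁ ℓ₂) →
    let open RealField ℝ
        open Hyperbola ℝ
    in
    (C₀ : Carrier) →
    Σ[ c₁ ∈ Carrier ] Σ[ c₂ ∈ Carrier ] Σ[ C ∈ Carrier ]
      (0# < c₁ × c₁ < c₂ × 0# < C ×
       ((X H M : Carrier) → 1# ≤ X → 1# ≤ H → 1# ≤ M →
        X ^1/ 3 ≤ H → H ≤ X → M ≤ C₀ * X ^1/ 2 →
        (J : Interval) → within J ⊆ within ⦅ M , 2# * M ⦆ˡ →
        (Q : ℤ) → M / H ≤ fromℤ Q → fromℤ Q ≤ M / (H * X) ^1/ 4 →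
        Decomposition c₁ c₂ C X H M J Q))
theorem8p1 ℝ C₀ =
  1# / 16ₙ , 3ₙ + D , constant D , 0<1/16 , 1/16< (0<C₀²+1 C₀) , 0<constant (0<C₀²+1 C₀) , decompose C₀
  where
  open RealField ℝ
  open Estimates ℝ
  open Main ℝ
  D = C₀ * C₀ + 1#
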